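{- Let $n>75$ be even. (1) If there exist a Steiner quadruple system $S_{2n+2}$ of order $2n+2$ and a $3$-BBD$(n)$ $B_n$, then there exists a Steiner quadruple system $S_{8n+2}$ of order $8n+2$ such that (copies of) $S_{2n+2}$ and $B_n$ are contained in $S_{8n+2}$, i.e. the block sets of $S_{2n+2}$ and of $B_n$, placed on suitable subsets of the point set of $S_{8n+2}$ of sizes $2n+2$ and $n$ respectively, are subsets of the block set of $S_{8n+2}$. (2) If there exist an $S(3,\{4,6\},2n+2)$ design $S_{2n+2}$ and a $3$-BBD$(n)$ $B_n$, then there exists an $S(3,\{4,6\},8n+2)$ design $S_{8n+2}$ containing (copies of) $S_{2n+2}$ and $B_n$ in the same sense.
   Context: A Steiner quadruple system of order $v$, $S(3,4,v)$, is a pair $(X,B)$ with $|X|=v$ and $B$ a set of $4$-element subsets of $X$ such that every $3$-subset of $X$ lies in exactly one block. An $S(3,\{4,6\},v)$ is a pair $(X,B)$ with $|X|=v$ and $B$ a set of subsets of $X$ each of size $4$ or $6$, such that every $3$-subset of $X$ lies in exactly one block. A $3$-BBD$(n)$ is a triple $(X,\{g_1,g_2\},B)$ where $|X|=n$, $\{g_1,g_2\}$ is a partition of $X$ with $|g_1|=|g_2|$, and $B$ is a set of $4$-element subsets of $X$ with $|b\cap g_1|=|b\cap g_2|=2$ for all $b\in B$, such that every $3$-subset of $X$ meeting both $g_1$ and $g_2$ lies in exactly one block. -}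

module Defs where

open import Data.Fin using (Fin)
open import Data.Fin.Properties using (any?; _≟_)
open import Data.Fin.Subset
  using (Subset; _∈_; _⊆_; _∩_; _∪_; ∣_∣; Nonempty; inside; ⊤; ⊥)
open import Data.Fin.Subset.Properties using (_∈?_)
open import Data.Nat using (ℕ)
open import Data.Product using (Σ-syntax; ∃-syntax; ∃!; _×_; _,_)
open import Data.Sum using (_⊎_)
open import Data.Vec using (tabulate)
open import Data.Vec.Properties using (lookup∘tabulate; []=⇒lookup; lookup⇒[]=)
open import Function using (_⇔_; mk⇔; Injective)
open import Level using (0ℓ)
open import Relation.Binary.PropositionalEquality using (_≡_; sym; trans)
open import Relation.Nullary.Decidable
  using (Dec; does; yes; no; dec-true; _×-dec_)
open import Relation.Unary using (Pred)

-- A design on v points has point set Fin v.  Its set of blocks is a predicate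
-- on the subsets of Fin v, so blocks carry no multiplicity.
BlockSet : ℕ → Set₁
BlockSet v = Pred (Subset v) 0ℓ

InExactlyOneBlock : ∀ {v} → BlockSet v → Subset v → Set
InExactlyOneBlock Block t = ∃! _≡_ λ b → Block b × t ⊆ b

-- S(3,K,v), with the set K of admissible block sizes given as a predicate.
record SteinerSystem₃ (K : Pred ℕ 0ℓ) (v : ℕ) : Set₁ where
  field
    Block     : BlockSet v
    blockSize : ∀ {b} → Block b → K ∣ b ∣
    covers    : ∀ t → ∣ t ∣ ≡ 3 → InExactlyOneBlock Block t

SteinerQuadrupleSystem : ℕ → Set₁
SteinerQuadrupleSystem v = SteinerSystem₃ (λ k → k ≡ 4) v

S₃⟨4,6⟩ : ℕ → Set₁
S₃⟨4,6⟩ v = SteinerSystem₃ (λ k → k ≡ 4 ⊎ k ≡ 6) v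

record 3-BBD (n : ℕ) : Set₁ where
  field
    g₁ g₂     : Subset n
    disjoint  : g₁ ∩ g₂ ≡ ⊥
    exhaust   : g₁ ∪ g₂ ≡ ⊤
    equalSize : ∣ g₁ ∣ ≡ ∣ g₂ ∣
    Block     : BlockSet n
    blockSize : ∀ {b} → Block b → ∣ b ∣ ≡ 4
    balanced  : ∀ {b} → Block b → ∣ b ∩ g₁ ∣ ≡ 2 × ∣ b ∩ g₂ ∣ ≡ 2
    covers    : ∀ t → ∣ t ∣ ≡ 3 → Nonempty (t ∩ g₁) → Nonempty (t ∩ g₂) →
                InExactlyOneBlock Block t

private
  preimage? : ∀ {m v} (f : Fin m → Fin v) (s : Subset m) (y : Fin v) →
              Dec (∃[ x ] x ∈ s × f x ≡ y)
  preimage? f s y = any? λ x → (x ∈? s) ×-dec (f x ≟ y)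

image : ∀ {m v} → (Fin m → Fin v) → Subset m → Subset v
image f s = tabulate λ y → does (preimage? f s y)

∈-image : ∀ {m v} (f : Fin m → Fin v) (s : Subset m) (y : Fin v) →
          y ∈ image f s ⇔ (∃[ x ] x ∈ s × f x ≡ y)
∈-image f s y = mk⇔ to from
  where
  lookup-image = lookup∘tabulate (λ z → does (preimage? f s z)) y

  to : y ∈ image f s → ∃[ x ] x ∈ s × f x ≡ y
  to y∈ with preimage? f s y | trans (sym lookup-image) ([]=⇒lookup y∈)
  ... | yes p | _  = p
  ... | no  _ | ()

  from : (∃[ x ] x ∈ s × f x ≡ y) → y ∈ image f s
  from p = lookup⇒[]= y (image f s)
             (trans lookup-image (dec-true (preimage? f s y) p))

infix 4 _ContainsCopyOf_

-- The image of the injection is the suitable subset of the larger point set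
-- on which the smaller block set is placed.
_ContainsCopyOf_ : ∀ {v m} → BlockSet v → BlockSet m → Set
_ContainsCopyOf_ {v} {m} Block′ Block =
  Σ[ f ∈ (Fin m → Fin v) ]
    Injective _≡_ _≡_ f × (∀ {b} → Block b → Block′ (image f b))

{-# OPTIONS --safe #-}
module Submission where

-- The points of the new system are two points ∞ together with two copies, left
-- and right, of ℤ/4n.  For each copy s and parity t, the residues of parity t
-- in s together with the two points ∞ form a flat of 2n+2 points, which carries
-- a copy of S.  On each copy, a 3-BBD(4n) with the two parity classes as its
-- groups, obtained from B by replacing each point with four, covers the
-- triples inside that copy that are not in a flat.
--
-- The other triples are covered by the blocks {u, v} ∪ {p, q} with u, v on the
-- left, p, q on the right and u + v + p + q + 1 = 0.  If u = v, the second u is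
-- replaced by a point ∞.  Since 2u = -(p + q + 1) has two solutions, which
-- differ by 2n, the label of that point must distinguish u from u + 2n and be
-- the same when computed from p and from q: it is χ (u + p), where χ changes
-- value under translation by 2n and is invariant under k ↦ -1 - k.

open import Defs
open import Data.Empty using (⊥-elim)
open import Data.Fin using (Fin; zero; suc; toℕ; fromℕ<)
import Data.Fin.Properties as Fin
open import Data.Fin.Permutation using (↔⇒≡)
open import Data.Fin.Subset
  using (Subset; _∈_; _∉_; _⊆_; _∩_; _∪_; ∣_∣; ⁅_⁆; Nonempty; inside; outside; ⊥)
open import Data.Fin.Subset.Properties
  using (x∈⁅x⁆; x∈⁅y⁆⇒x≡y; x∈p∪q⁺; x∈p∪q⁻; x∈p∩q⁺; ∈⊤; ∉⊥; ∣⊥∣≡0; ∪-identityˡ;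
         q⊆p∪q; ⊆-antisym; p⊆q⇒∣p∣≤∣q∣)
open import Data.List using (List; []; _∷_; _++_; foldr; length; lookup; map; mapMaybe)
open import Data.List.Membership.Propositional using () renaming (_∈_ to _∈ₗ_)
open import Data.List.Membership.Propositional.Properties using (∈-map⁺; ∈-map⁻; ∈-∃++; ∈-lookup)
open import Data.List.Properties using (length-map; length-++; map-∘; map-cong; map-id)
open import Data.List.Relation.Binary.Permutation.Propositional
  using (_↭_; refl; prep; swap; ↭-refl; ↭-trans; ↭-sym; ↭⇒↭ₛ)
open import Data.List.Relation.Binary.Permutation.Propositional.Properties
  using (∈-resp-↭; All-resp-↭; ↭-length; map⁺; mapMaybe-↭; shift; ++-comm; drop-∷;
         ↭-empty-inv; ↭-singleton-inv)
import Data.List.Relation.Binary.Permutation.Setoid.Properties as Permutationₛ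
open import Data.List.Relation.Unary.All as All using (All; []; _∷_)
import Data.List.Relation.Unary.All.Properties as All
open import Data.List.Relation.Unary.AllPairs using ([]; _∷_)
open import Data.List.Relation.Unary.Any using (here; there; index)
open import Data.List.Relation.Unary.Any.Properties using (lookup-index)
open import Data.List.Relation.Unary.Unique.Propositional using (Unique)
import Data.List.Relation.Unary.Unique.Propositional.Properties as Unique
open import Data.Maybe using (Maybe; just; nothing)
open import Data.Nat
  using (ℕ; zero; suc; NonZero; >-nonZero; _+_; _*_; _∸_; _/_; _%_; _≤_; _<_; z≤n; s≤s; parity)
open import Data.Nat.Divisibility
open import Data.Nat.DivMod
open import Data.Nat.ListAction using (sum)
open import Data.Nat.ListAction.Properties using (sum-↭)
import Data.Nat.Properties as ℕ
open import Data.Nat.Tactic.RingSolver using (solve-∀)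
open import Data.Parity using (Parity; 0ℙ; 1ℙ; _⁻¹) renaming (_+_ to _⊕_)
import Data.Parity.Properties as ℙ
open import Data.Product using (Σ-syntax; ∃-syntax; ∃₂; _×_; _,_; proj₁; proj₂)
open import Data.Product.Algebra using (×-assoc)
open import Data.Product.Function.NonDependent.Propositional using (_×-↔_)
open import Data.Sum using (_⊎_; inj₁; inj₂)
open import Data.Sum.Function.Propositional using (_⊎-↔_)
open import Data.Unit using (⊤; tt)
open import Data.Vec using ([]; _∷_; here; there)
open import Function
  using (_∘_; case_of_; _↔_; mk↔ₛ′; mk⤖; Inverse; Injection; Injective; Equivalence)
open import Function.Properties.Bijection using (⤖⇒↔)
open import Function.Properties.Inverse using (↔⇒↣; ↔-sym; ↔-refl; ↔-trans)
open import Level using (0ℓ)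
open import Relation.Binary.PropositionalEquality
open import Relation.Nullary using (¬_; Dec; yes; no; contradiction)
open import Relation.Nullary.Decidable using (_×-dec_)
open import Relation.Unary using (Pred)

-- Finite subsets as lists

private variable
  m n : ℕ

Unique-resp-↭ : ∀ {A : Set} {xs ys : List A} → xs ↭ ys → Unique xs → Unique ys
Unique-resp-↭ p = Permutationₛ.Unique-resp-↭ (setoid _) (↭⇒↭ₛ p)

∈-strip : ∀ {A : Set} {x : A} {xs} → x ∈ₗ xs → ∃[ ys ] xs ↭ x ∷ ys
∈-strip x∈xs with ∈-∃++ x∈xs
... | ys , zs , refl = ys ++ zs , shift _ ys zs

⊆-complement : ∀ {A : Set} {xs ys : List A} → Unique xs → (∀ {x} → x ∈ₗ xs → x ∈ₗ ys) →
               ∃[ zs ] ys ↭ xs ++ zs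
⊆-complement {ys = ys} [] _ = ys , ↭-refl
⊆-complement {xs = x ∷ xs} (x∉ ∷ u) xs⊆ys with ∈-strip (xs⊆ys (here refl))
... | ys′ , σ with ⊆-complement u xs⊆ys′
  where
  xs⊆ys′ : ∀ {y} → y ∈ₗ xs → y ∈ₗ ys′
  xs⊆ys′ y∈ with ∈-resp-↭ σ (xs⊆ys (there y∈))
  ... | here refl = ⊥-elim (All.lookup x∉ y∈ refl)
  ... | there y∈′ = y∈′
... | zs , τ = zs , ↭-trans σ (prep x τ)

-- The complement of `xs` in `ys` has length one. This is how a quad containing a given triple is
-- written, up to order, as the triple and one further point.
⊆-add-one : ∀ {A : Set} {xs ys : List A} → Unique xs → length ys ≡ suc (length xs) →
            (∀ {x} → x ∈ₗ xs → x ∈ₗ ys) → ∃[ w ] ys ↭ w ∷ xs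
⊆-add-one {xs = xs} {ys} u len xs⊆ys with ⊆-complement u xs⊆ys
... | zs , σ = single zs length-zs (↭-trans σ (++-comm xs zs))
  where
  length-zs : length zs ≡ 1
  length-zs = ℕ.+-cancelˡ-≡ (length xs) _ _ (trans (sym (length-++ xs))
    (trans (sym (↭-length σ)) (trans len (ℕ.+-comm 1 (length xs)))))
  single : ∀ zs → length zs ≡ 1 → ys ↭ zs ++ xs → ∃[ w ] ys ↭ w ∷ xs
  single (w ∷ []) _ τ = w , τ

set : List (Fin n) → Subset n
set = foldr (λ x p → ⁅ x ⁆ ∪ p) ⊥

∈-set⁺ : ∀ {x : Fin n} {xs} → x ∈ₗ xs → x ∈ set xs
∈-set⁺ (here refl) = x∈p∪q⁺ (inj₁ (x∈⁅x⁆ _))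
∈-set⁺ (there x∈)  = x∈p∪q⁺ (inj₂ (∈-set⁺ x∈))

∈-set⁻ : ∀ {x : Fin n} xs → x ∈ set xs → x ∈ₗ xs
∈-set⁻ []       x∈ = ⊥-elim (∉⊥ x∈)
∈-set⁻ (y ∷ xs) x∈ with x∈p∪q⁻ ⁅ y ⁆ (set xs) x∈
... | inj₁ x∈⁅y⁆ = here (x∈⁅y⁆⇒x≡y y x∈⁅y⁆)
... | inj₂ x∈xs  = there (∈-set⁻ xs x∈xs)

set-⊆ : ∀ {xs} {p : Subset n} → (∀ {x} → x ∈ₗ xs → x ∈ p) → set xs ⊆ p
set-⊆ xs⊆p x∈ = xs⊆p (∈-set⁻ _ x∈)

set-↭ : ∀ {xs ys : List (Fin n)} → xs ↭ ys → set xs ≡ set ys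
set-↭ σ = ⊆-antisym (set-⊆ (∈-set⁺ ∘ ∈-resp-↭ σ)) (set-⊆ (∈-set⁺ ∘ ∈-resp-↭ (↭-sym σ)))

∣⁅x⁆∪p∣ : ∀ (x : Fin n) p → x ∉ p → ∣ ⁅ x ⁆ ∪ p ∣ ≡ suc ∣ p ∣
∣⁅x⁆∪p∣ zero    (inside  ∷ p) x∉p = ⊥-elim (x∉p here)
∣⁅x⁆∪p∣ zero    (outside ∷ p) x∉p = cong (suc ∘ ∣_∣) (∪-identityˡ p)
∣⁅x⁆∪p∣ (suc x) (inside  ∷ p) x∉p = cong suc (∣⁅x⁆∪p∣ x p (x∉p ∘ there))
∣⁅x⁆∪p∣ (suc x) (outside ∷ p) x∉p = ∣⁅x⁆∪p∣ x p (x∉p ∘ there)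

∣set∣ : ∀ {xs : List (Fin n)} → Unique xs → ∣ set xs ∣ ≡ length xs
∣set∣ {n}           []        = ∣⊥∣≡0 n
∣set∣ {xs = x ∷ xs} (x∉ ∷ u) =
  trans (∣⁅x⁆∪p∣ x (set xs) (λ x∈ → All.lookup x∉ (∈-set⁻ xs x∈) refl)) (cong suc (∣set∣ u))

length≤∣∣ : ∀ {xs} {p : Subset n} → Unique xs → (∀ {x} → x ∈ₗ xs → x ∈ p) → length xs ≤ ∣ p ∣
length≤∣∣ {p = p} u xs⊆p = subst (_≤ ∣ p ∣) (∣set∣ u) (p⊆q⇒∣p∣≤∣q∣ (set-⊆ xs⊆p))

set-map-suc : ∀ (xs : List (Fin n)) → set (map suc xs) ≡ outside ∷ set xs
set-map-suc []       = refl
set-map-suc (x ∷ xs) = cong (⁅ suc x ⁆ ∪_) (set-map-suc xs)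

elements : ∀ (p : Subset n) → ∃[ xs ] Unique xs × p ≡ set xs
elements []            = [] , [] , refl
elements (outside ∷ p) with elements p
... | xs , u , refl = map suc xs , Unique.map⁺ Fin.suc-injective u , sym (set-map-suc xs)
elements (inside ∷ p) with elements p
... | xs , u , refl =
  zero ∷ map suc xs
  , All.map⁺ (All.universal (λ _ ()) xs) ∷ Unique.map⁺ Fin.suc-injective u
  , trans (cong (inside ∷_) (sym (∪-identityˡ (set xs)))) (cong (⁅ zero ⁆ ∪_) (sym (set-map-suc xs)))

elements-of-size : ∀ {k} (p : Subset n) → ∣ p ∣ ≡ k →
                   ∃[ xs ] Unique xs × p ≡ set xs × length xs ≡ k
elements-of-size p ∣p∣≡k with elements p
... | xs , u , p≡ = xs , u , p≡ , trans (sym (∣set∣ u)) (trans (cong ∣_∣ (sym p≡)) ∣p∣≡k)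

extend-to : ∀ {xs} {p : Subset n} → Unique xs → ∣ p ∣ ≡ suc (length xs) → set xs ⊆ p →
            ∃[ w ] Unique (w ∷ xs) × p ≡ set (w ∷ xs)
extend-to {p = p} u ∣p∣≡ xs⊆p with elements-of-size p ∣p∣≡
... | ys , u′ , refl , len with ⊆-add-one u len (λ x∈ → ∈-set⁻ ys (xs⊆p (∈-set⁺ x∈)))
... | w , σ = w , Unique-resp-↭ σ u′ , set-↭ σ

set-∷-injective : ∀ {x y : Fin n} {xs} → All (x ≢_) xs → set (x ∷ xs) ≡ set (y ∷ xs) → x ≡ y
set-∷-injective {x = x} {y} {xs} x∉ eq
  with ∈-set⁻ (y ∷ xs) (subst (x ∈_) eq (∈-set⁺ {xs = x ∷ xs} (here refl)))
... | here x≡y  = x≡y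
... | there x∈  = ⊥-elim (All.lookup x∉ x∈ refl)

module _ (f : Fin m → Fin n) where

  ∈-image⁺ : ∀ {x p} → x ∈ p → f x ∈ image f p
  ∈-image⁺ {x} {p} x∈p = Equivalence.from (∈-image f p (f x)) (x , x∈p , refl)

  ∈-image⁻ : ∀ {y p} → y ∈ image f p → ∃[ x ] x ∈ p × f x ≡ y
  ∈-image⁻ {y} {p} = Equivalence.to (∈-image f p y)

  image-set : ∀ xs → image f (set xs) ≡ set (map f xs)
  image-set xs = ⊆-antisym ⊆set set⊆
    where
    ⊆set : image f (set xs) ⊆ set (map f xs)
    ⊆set y∈ with ∈-image⁻ y∈
    ... | x , x∈ , refl = ∈-set⁺ (∈-map⁺ f (∈-set⁻ xs x∈))
    set⊆ : set (map f xs) ⊆ image f (set xs)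
    set⊆ = set-⊆ λ y∈ → case-map (∈-map⁻ f y∈)
      where
      case-map : ∀ {y} → (∃[ x ] x ∈ₗ xs × y ≡ f x) → y ∈ image f (set xs)
      case-map (x , x∈ , refl) = ∈-image⁺ (∈-set⁺ x∈)

  ∣image∣ : Injective _≡_ _≡_ f → ∀ p → ∣ image f p ∣ ≡ ∣ p ∣
  ∣image∣ f-inj p with elements p
  ... | xs , u , refl = trans (cong ∣_∣ (image-set xs))
    (trans (∣set∣ (Unique.map⁺ f-inj u)) (trans (length-map f xs) (sym (∣set∣ u))))

  ∈-image-injective : Injective _≡_ _≡_ f → ∀ {x p} → f x ∈ image f p → x ∈ p
  ∈-image-injective f-inj {p = p} fx∈ with ∈-image⁻ fx∈
  ... | x′ , x′∈ , eq = subst (_∈ p) (f-inj eq) x′∈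

-- Quadruple systems from flats and quads

Fresh : {A : Set} → A → List A → Set
Fresh w = All (w ≢_)

-- An abstract setting: `I` indexes the flats, and `R` selects the quads among the lists of four
-- distinct points.
module Assembly {X I : Set} (Flat : I → X → Set) (R : List X → Set) where

  InFlat : List X → Set
  InFlat ts = ∃[ i ] All (Flat i) ts

  -- Only fresh points count as completions, since `R` can hold of a list with a repeated point,
  -- which gives no block. Inside a flat no quad may contain the triple, because the copy of `S`
  -- covers it already.
  data Covered (ts : List X) : Set where
    inFlat  : InFlat ts → (∀ {w} → Fresh w ts → ¬ R (w ∷ ts)) → Covered ts
    offFlat : ∀ w → ¬ InFlat ts → Fresh w ts → R (w ∷ ts) →
              (∀ {w′} → Fresh w′ ts → R (w′ ∷ ts) → w′ ≡ w) → Covered ts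

  module _ (R-resp-↭ : ∀ {xs ys} → xs ↭ ys → R xs → R ys) where

    Covered-resp-↭ : ∀ {ts us} → ts ↭ us → Covered ts → Covered us
    Covered-resp-↭ σ (inFlat (i , fs) ¬R) = inFlat (i , All-resp-↭ σ fs)
      λ fr r → ¬R (All-resp-↭ (↭-sym σ) fr) (R-resp-↭ (prep _ (↭-sym σ)) r)
    Covered-resp-↭ σ (offFlat w ¬flat fr r uniq) =
      offFlat w (λ (i , fs) → ¬flat (i , All-resp-↭ (↭-sym σ) fs))
        (All-resp-↭ σ fr) (R-resp-↭ (prep _ σ) r)
        λ fr′ r′ → uniq (All-resp-↭ (↭-sym σ) fr′) (R-resp-↭ (prep _ (↭-sym σ)) r′)

    module System {m v} {K : Pred ℕ 0ℓ} (K4 : K 4) (S : SteinerSystem₃ K m)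
             (points : X ↔ Fin v)
             (φ : I → Fin m → X)
             (φ-injective : ∀ i → Injective _≡_ _≡_ (φ i))
             (φ-flat : ∀ i a → Flat i (φ i a))
             (φ-onto : ∀ i {x} → Flat i x → ∃[ a ] φ i a ≡ x)
             (flats-meet : ∀ {i j ts} → Unique ts → length ts ≡ 3 →
                           All (Flat i) ts → All (Flat j) ts → i ≡ j)
             (cover : ∀ {ts} → Unique ts → length ts ≡ 3 → Covered ts)
             where

      private module S = SteinerSystem₃ S

      enc : X → Fin v
      enc = Inverse.to points

      enc-injective : Injective _≡_ _≡_ enc
      enc-injective = Injection.injective (↔⇒↣ points)

      place : I → Fin m → Fin v
      place i = enc ∘ φ i

      place-injective : ∀ i → Injective _≡_ _≡_ (place i)
      place-injective i = φ-injective i ∘ enc-injective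

      data Block : BlockSet v where
        flat : ∀ i {c} → S.Block c → Block (image (place i) c)
        quad : ∀ {xs} → Unique xs → length xs ≡ 4 → R xs → Block (set (map enc xs))

      blockSize : ∀ {b} → Block b → K ∣ b ∣
      blockSize (flat i {c} Sc) =
        subst K (sym (∣image∣ (place i) (place-injective i) c)) (S.blockSize Sc)
      blockSize (quad {xs} u len _) =
        subst K (sym (trans (∣set∣ (Unique.map⁺ enc-injective u)) (trans (length-map enc xs) len))) K4

      ∈-set-enc : ∀ {x} xs → enc x ∈ set (map enc xs) → x ∈ₗ xs
      ∈-set-enc xs x∈ with ∈-map⁻ enc (∈-set⁻ (map enc xs) x∈)
      ... | y , y∈ , eq = subst (_∈ₗ xs) (sym (enc-injective eq)) y∈

      pointsOf : ∀ t → ∣ t ∣ ≡ 3 → ∃[ ts ] Unique ts × length ts ≡ 3 × t ≡ set (map enc ts)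
      pointsOf t ∣t∣≡3 with elements-of-size t ∣t∣≡3
      ... | xs , u , t≡ , len = map (Inverse.from points) xs
        , Unique.map⁺ (Injection.injective (↔⇒↣ (↔-sym points))) u
        , trans (length-map _ xs) len
        , trans t≡ (cong set (trans (sym (map-id xs))
            (trans (map-cong (λ x → sym (Inverse.strictlyInverseˡ points x)) xs) (map-∘ xs))))

      quad-⊇ : ∀ {ts xs} → Unique ts → length ts ≡ 3 → Unique xs → length xs ≡ 4 →
               set (map enc ts) ⊆ set (map enc xs) → ∃[ w ] xs ↭ w ∷ ts
      quad-⊇ u len u′ len′ t⊆ = ⊆-add-one u (trans len′ (cong suc (sym len)))
        λ x∈ → ∈-set-enc _ (t⊆ (∈-set⁺ (∈-map⁺ enc x∈)))

      preimages : ∀ i {ts} → All (Flat i) ts → ∃[ as ] map (φ i) as ≡ ts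
      preimages i [] = [] , refl
      preimages i (f ∷ fs) with φ-onto i f | preimages i fs
      ... | a , refl | as , refl = a ∷ as , refl

      fresh-unique : ∀ {w : X} {ts xs} → xs ↭ w ∷ ts → Unique xs → Fresh w ts
      fresh-unique σ u with Unique-resp-↭ σ u
      ... | fr ∷ _ = fr

      flat-⊇ : ∀ i {ts c} → set (map enc ts) ⊆ image (place i) c → All (Flat i) ts
      flat-⊇ i t⊆ = All.tabulate λ x∈ → flat∈ (∈-image⁻ (place i) (t⊆ (∈-set⁺ (∈-map⁺ enc x∈))))
        where
        flat∈ : ∀ {x c} → (∃[ a ] a ∈ c × place i a ≡ enc x) → Flat i x
        flat∈ (a , _ , eq) = subst (Flat i) (enc-injective eq) (φ-flat i a)

      covers : ∀ t → ∣ t ∣ ≡ 3 → InExactlyOneBlock Block t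
      covers t ∣t∣≡3 with pointsOf t ∣t∣≡3
      ... | ts , u , len , refl with cover u len
      ... | offFlat w ¬flat fr r uniq =
        set (map enc (w ∷ ts))
        , (quad (fr ∷ u) (cong suc len) r , q⊆p∪q _ _)
        -- A flat block through the triple would put it in a flat. A quad through it is the triple
        -- and one fresh point, which `uniq` identifies with `w`.
        , λ { (flat i _ , t⊆) → ⊥-elim (¬flat (i , flat-⊇ i {ts} t⊆))
            ; (quad {xs} u′ len′ r′ , t⊆) → same u′ r′ (quad-⊇ u len u′ len′ t⊆) }
        where
        same : ∀ {xs} → Unique xs → R xs → ∃[ w′ ] xs ↭ w′ ∷ ts →
               set (map enc (w ∷ ts)) ≡ set (map enc xs)
        same u′ r′ (w′ , σ) with refl ← uniq (fresh-unique σ u′) (R-resp-↭ σ r′) =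
          sym (set-↭ (map⁺ enc σ))
      ... | inFlat (i , fs) ¬R with preimages i fs
      ... | as , refl
        -- Pulled back along `φ i`, the triple becomes three points of `S`, which lie in exactly one
        -- block there.
        with S.covers (set as) (trans (∣set∣ (Unique.map⁻ u)) (trans (sym (length-map (φ i) as)) len))
      ... | c , (Sc , as⊆c) , uniq =
        image (place i) c
        , (flat i Sc , t⊆image)
        -- Flats that share three points are equal, so uniqueness in `S` settles the flat blocks;
        -- `¬R` rules out the quads.
        , λ { (flat j Sc′ , t⊆) → same (flats-meet u len fs (flat-⊇ j {map (φ i) as} t⊆)) Sc′ t⊆
            ; (quad u′ len′ r′ , t⊆) → ⊥-elim (absurd u′ r′ (quad-⊇ u len u′ len′ t⊆)) }
        where
        place-as : map enc (map (φ i) as) ≡ map (place i) as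
        place-as = sym (map-∘ as)
        t⊆image : set (map enc (map (φ i) as)) ⊆ image (place i) c
        t⊆image rewrite place-as = set-⊆ {xs = map (place i) as} λ y∈ → in-image (∈-map⁻ (place i) y∈)
          where
          in-image : ∀ {y} → ∃[ a ] a ∈ₗ as × y ≡ place i a → y ∈ image (place i) c
          in-image (a , a∈ , refl) = ∈-image⁺ (place i) (as⊆c (∈-set⁺ a∈))
        same : ∀ {j c′} → i ≡ j → S.Block c′ → set (map enc (map (φ i) as)) ⊆ image (place j) c′ →
               image (place i) c ≡ image (place j) c′
        same refl Sc′ t⊆ = cong (image (place i)) (uniq (Sc′ , set-⊆ {xs = as} λ a∈ →
          ∈-image-injective (place i) (place-injective i) (t⊆ (∈-set⁺ (∈-map⁺ enc (∈-map⁺ (φ i) a∈))))))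
        absurd : ∀ {xs} → Unique xs → R xs → ¬ (∃[ w ] xs ↭ w ∷ map (φ i) as)
        absurd u′ r′ (w , σ) = ¬R (fresh-unique σ u′) (R-resp-↭ σ r′)

      system : SteinerSystem₃ K v
      system = record { Block = Block ; blockSize = blockSize ; covers = covers }

-- Residues modulo 4h

parity-even : ∀ k → parity (2 * k) ≡ 0ℙ
parity-even k = trans (ℙ.+-homo-+ k (k + 0))
  (trans (cong (λ j → parity k ⊕ parity j) (ℕ.+-identityʳ k)) (ℙ.p+p≡0ℙ (parity k)))

bit : Parity → ℕ
bit 0ℙ = 0
bit 1ℙ = 1

parity-bit : ∀ t k → parity (bit t + 2 * k) ≡ t
parity-bit t k = trans (ℙ.+-homo-+ (bit t) (2 * k))
  (trans (cong₂ _⊕_ (parity∘bit t) (parity-even k)) (ℙ.+-identityʳ t))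
  where
  parity∘bit : ∀ t → parity (bit t) ≡ t
  parity∘bit 0ℙ = refl
  parity∘bit 1ℙ = refl

halve : ∀ k → ∃₂ λ t j → bit t + 2 * j ≡ k
halve zero          = 0ℙ , 0 , refl
halve (suc zero)    = 1ℙ , 0 , refl
halve (suc (suc k)) with halve k
... | t , j , refl = t , suc j , step (bit t) j
  where
  step : ∀ b j → b + 2 * suc j ≡ suc (suc (b + 2 * j))
  step = solve-∀

odd-predecessor : ∀ {k} → parity k ≡ 1ℙ → ∃[ j ] suc k ≡ 2 * j
odd-predecessor {k} odd with halve k
... | 0ℙ , j , refl with () ← trans (sym odd) (parity-even j)
... | 1ℙ , j , refl = suc j , lemma j
  where
  lemma : ∀ j → suc (suc (2 * j)) ≡ 2 * suc j
  lemma = solve-∀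

-- The difference of two solutions is a multiple of `N` and less than `N`.
∣+-unique : ∀ {N a b} k → a < N → b < N → N ∣ k + a → N ∣ k + b → a ≡ b
∣+-unique {N} k = λ a<N b<N N∣k+a N∣k+b → case ℕ.≤-total _ _ of λ where
    (inj₁ a≤b) → ordered a≤b b<N N∣k+a N∣k+b
    (inj₂ b≤a) → sym (ordered b≤a a<N N∣k+b N∣k+a)
  where
  ordered : ∀ {a b} → a ≤ b → b < N → N ∣ k + a → N ∣ k + b → a ≡ b
  ordered {a} a≤b b<N N∣k+a N∣k+b with ℕ.m≤n⇒∃[o]m+o≡n a≤b
  ... | zero  , refl = sym (ℕ.+-identityʳ a)
  ... | suc d , refl = ⊥-elim (>⇒∤ (ℕ.≤-<-trans (ℕ.m≤n+m (suc d) a) b<N)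
    (∣m+n∣m⇒∣n (subst (N ∣_) (sym (ℕ.+-assoc k a (suc d))) N∣k+b) N∣k+a))

∣+-exists : ∀ N .{{_ : NonZero N}} k → ∃[ a ] a < N × N ∣ k + a
∣+-exists N k = r % N , m%n<n r N , ∣m+n∣m⇒∣n {m = r / N * N}
    (subst (N ∣_) eq (n∣m*n k)) (n∣m*n (r / N))
  where
  -- A representative of `-k` modulo `N`. The truncated subtraction is exact because `k ≤ k * N` for
  -- nonzero `N`.
  r = k * N ∸ k
  rearrange : ∀ a b c → a + (b + c) ≡ c + (a + b)
  rearrange = solve-∀
  eq : k * N ≡ r / N * N + (k + r % N)
  eq = trans (sym (ℕ.m+[n∸m]≡n (ℕ.m≤m*n k N)))
         (trans (cong (k +_) (m≡m%n+[m/n]*n r N)) (rearrange k (r % N) (r / N * N)))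

-- The residue k modulo 4h, encoded by the parity of k and ⌊k/2⌋.
record Residue (h : ℕ) : Set where
  constructor residue
  field
    par  : Parity
    half : Fin (2 * h)

open Residue

val : ∀ {h} → Residue h → ℕ
val g = bit (par g) + 2 * toℕ (half g)

parity-val : ∀ {h} (g : Residue h) → parity (val g) ≡ par g
parity-val g = parity-bit (par g) (toℕ (half g))

module Residues (h : ℕ) .{{_ : NonZero h}} where

  private
    G = Residue h

  opaque
    M N : ℕ
    M = 2 * h
    N = 2 * M

    instance
      M≢0 : NonZero M
      M≢0 = ℕ.m*n≢0 2 h
      N≢0 : NonZero N
      N≢0 = ℕ.m*n≢0 2 M

    val<N : ∀ (g : G) → val g < N
    val<N (residue t x) = ℕ.≤-trans (ℕ.+-monoˡ-≤ (2 * toℕ x) (bit<2 t))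
        (subst (_≤ N) (ℕ.*-suc 2 (toℕ x)) (ℕ.*-monoʳ-≤ 2 (Fin.toℕ<n x)))
      where
      bit<2 : ∀ t → bit t < 2
      bit<2 0ℙ = s≤s z≤n
      bit<2 1ℙ = s≤s (s≤s z≤n)

    val-injective : ∀ {g g′ : G} → val g ≡ val g′ → g ≡ g′
    val-injective {residue t x} {residue t′ x′} eq
      with refl ← trans (sym (parity-bit t (toℕ x))) (trans (cong parity eq) (parity-bit t′ (toℕ x′)))
      = cong (residue t) (Fin.toℕ-injective (ℕ.*-cancelˡ-≡ _ _ 2 (ℕ.+-cancelˡ-≡ (bit t) _ _ eq)))

    val-surjective : ∀ {k} → k < N → ∃[ g ] val {h} g ≡ k
    val-surjective {k} k<N with halve k
    ... | t , j , refl = residue t (fromℕ< j<M) , cong (λ i → bit t + 2 * i) (Fin.toℕ-fromℕ< j<M)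
      where
      j<M : j < M
      j<M = ℕ.*-cancelˡ-< 2 j M (ℕ.≤-<-trans (ℕ.m≤n+m (2 * j) (bit t)) k<N)

    solve-residue : ∀ k → ∃[ g ] N ∣ k + val {h} g
    solve-residue k with ∣+-exists N k
    ... | a , a<N , N∣ with val-surjective a<N
    ... | g , refl = g , N∣

    residue-unique : ∀ k {g g′ : G} → N ∣ k + val g → N ∣ k + val g′ → g ≡ g′
    residue-unique k {g} {g′} N∣ N∣′ = val-injective (∣+-unique k (val<N g) (val<N g′) N∣ N∣′)

    odd-parity : ∀ {k} → N ∣ suc k → parity k ≡ 1ℙ
    odd-parity {k} (divides q eq) = trans (sym (ℙ.suc-homo-⁻¹ k)) (cong _⁻¹
      (trans (cong parity (trans eq (rearrange q M))) (parity-even (q * M))))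
      where
      rearrange : ∀ q M → q * (2 * M) ≡ 2 * (q * M)
      rearrange = solve-∀

    -- χ is the indicator of [h, 3h) on residues modulo 4h.
    χ : ℕ → Parity
    χ k = parity ((k + h) / M)

    -- Adding `j * M` raises the quotient by exactly `j`. So `χ` distinguishes `u` from `u + M` and
    -- has period `N`.
    χ-shift : ∀ k j → χ (k + j * M) ≡ χ k ⊕ parity j
    χ-shift k j = trans (cong parity quotient-shift) (ℙ.+-homo-+ ((k + h) / M) j)
      where
      rearrange : ∀ k a h → k + a + h ≡ (k + h) + a
      rearrange = solve-∀
      quotient-shift : (k + j * M + h) / M ≡ (k + h) / M + j
      quotient-shift = trans (/-congˡ {o = M} (rearrange k (j * M) h))
        (trans (+-distrib-/-∣ʳ (k + h) {d = M} (n∣m*n j)) (cong ((k + h) / M +_) (m*n/n≡m j M)))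

    -- The interval [h, 3h) is mapped to itself by k ↦ 4h - 1 - k. In terms of quotients:
    -- `K + K′ + 1` is an odd multiple of `M`, so the quotients of `K` and `K′` by `M` have an even
    -- sum.
    χ-reflect : ∀ k k′ → N ∣ suc (k + k′) → χ k ≡ χ k′
    χ-reflect k k′ (divides q eq) = ℙ.+-cancelʳ-≡ (parity a) _ _ (trans (ℙ.p+p≡0ℙ (parity a)) (sym
        (trans (sym (ℙ.+-homo-+ (K′ / M) a)) (trans (cong parity quotients) (parity-even q)))))
      where
      K K′ a r r′ : ℕ
      K = k + h
      K′ = k′ + h
      a = K / M
      r = K % M
      -- This is the remainder of `K′`. The extra one in the hypothesis makes it smaller than `M`
      -- even when `r` is zero.
      r′ = M ∸ suc r
      r+r′ : suc r + r′ ≡ M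
      r+r′ = ℕ.m+[n∸m]≡n (m%n<n K M)
      r′<M : r′ < M
      r′<M = subst (suc r′ ≤_) r+r′ (s≤s (ℕ.m≤n+m r′ r))
      rearrange₁ : ∀ r K′ aM → suc r + (K′ + aM) ≡ suc ((r + aM) + K′)
      rearrange₁ = solve-∀
      rearrange₂ : ∀ k k′ h → suc ((k + h) + (k′ + h)) ≡ suc (k + k′) + 2 * h
      rearrange₂ = solve-∀
      rearrange₃ : ∀ q M → q * (2 * M) + M ≡ M + (2 * q) * M
      rearrange₃ = solve-∀
      remainder : K′ + a * M ≡ r′ + (2 * q) * M
      remainder = ℕ.+-cancelˡ-≡ (suc r) _ _ (begin
        suc r + (K′ + a * M)           ≡⟨ rearrange₁ r K′ (a * M) ⟩
        suc ((r + a * M) + K′)         ≡⟨ cong (λ j → suc (j + K′)) (m≡m%n+[m/n]*n K M) ⟨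
        suc (K + K′)                   ≡⟨ rearrange₂ k k′ h ⟩
        suc (k + k′) + M               ≡⟨ cong (_+ M) eq ⟩
        q * N + M                      ≡⟨ rearrange₃ q M ⟩
        M + 2 * q * M                  ≡⟨ cong (_+ 2 * q * M) r+r′ ⟨
        suc r + r′ + 2 * q * M         ≡⟨ ℕ.+-assoc (suc r) r′ _ ⟩
        suc r + (r′ + 2 * q * M)       ∎)
        where open ≡-Reasoning
      quotients : K′ / M + a ≡ 2 * q
      quotients = begin
        K′ / M + a                     ≡⟨ cong (K′ / M +_) (m*n/n≡m a M) ⟨
        K′ / M + a * M / M             ≡⟨ +-distrib-/-∣ʳ K′ {d = M} (n∣m*n a) ⟨
        (K′ + a * M) / M               ≡⟨ /-congˡ {o = M} remainder ⟩
        (r′ + 2 * q * M) / M           ≡⟨ +-distrib-/-∣ʳ r′ {d = M} (n∣m*n (2 * q)) ⟩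
        r′ / M + 2 * q * M / M         ≡⟨ cong₂ _+_ (m<n⇒m/n≡0 {n = M} r′<M) (m*n/n≡m (2 * q) M) ⟩
        2 * q                          ∎
        where open ≡-Reasoning

    -- Both sides are `χ (u + u′ + c + p)`, evaluated by reading either `c + u′` or `c + u` as a
    -- multiple of `M`.
    χ-quotients : ∀ {c u u′ a b} p → c + u ≡ a * M → c + u′ ≡ b * M →
                  χ (u + p) ⊕ parity b ≡ χ (u′ + p) ⊕ parity a
    χ-quotients {c} {u} {u′} {a} {b} p eq eq′ = begin
      χ (u + p) ⊕ parity b   ≡⟨ χ-shift (u + p) b ⟨
      χ (u + p + b * M)      ≡⟨ cong (λ j → χ (u + p + j)) eq′ ⟨
      χ (u + p + (c + u′))   ≡⟨ cong χ (rearrange u p c u′) ⟩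
      χ (u′ + p + (c + u))   ≡⟨ cong (λ j → χ (u′ + p + j)) eq ⟩
      χ (u′ + p + a * M)     ≡⟨ χ-shift (u′ + p) a ⟩
      χ (u′ + p) ⊕ parity a  ∎
      where
      open ≡-Reasoning
      rearrange : ∀ u p c u′ → u + p + (c + u′) ≡ u′ + p + (c + u)
      rearrange = solve-∀

    private
      halved : ∀ {s c} u → suc s ≡ 2 * c → suc (u + u + s) ≡ 2 * (c + u)
      halved {s} {c} u eq = trans (lemma u s) (trans (cong (2 * u +_) eq) (lemma′ u c))
        where
        lemma : ∀ u s → suc (u + u + s) ≡ 2 * u + suc s
        lemma = solve-∀
        lemma′ : ∀ u c → 2 * u + 2 * c ≡ 2 * (c + u)
        lemma′ = solve-∀

      -- Adding `bit t * M` makes both quotients even, which turns the multiples of `M` into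
      -- multiples of `N` and reduces the claim to `residue-unique`.
      same-parity-unique : ∀ {c a b} {g g′ : G} → c + val g ≡ a * M → c + val g′ ≡ b * M →
                           parity a ≡ parity b → g ≡ g′
      same-parity-unique {c} {a} {b} {g} {g′} eq eq′ par≡ with halve a | halve b
      ... | t , a′ , refl | t′ , b′ , refl
        with refl ← trans (sym (parity-bit t a′)) (trans par≡ (parity-bit t′ b′))
        = residue-unique (bit t * M + c) (N∣ {j = a′} eq) (N∣ {j = b′} eq′)
        where
        lemma : ∀ s a M → s * M + (s + 2 * a) * M ≡ (s + a) * (2 * M)
        lemma = solve-∀
        N∣ : ∀ {v j} → c + v ≡ (bit t + 2 * j) * M → N ∣ bit t * M + c + v
        N∣ {v} {j} eq = divides (bit t + j) (trans (ℕ.+-assoc (bit t * M) c v)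
          (trans (cong (bit t * M +_) eq) (lemma (bit t) j M)))

    double-divides : ∀ {s} c u → suc s ≡ 2 * c → N ∣ suc (u + u + s) → M ∣ c + u
    double-divides c u eq N∣ = *-cancelˡ-∣ {m = M} {n = c + u} 2 (subst (N ∣_) (halved {c = c} u eq) N∣)

    divides-double : ∀ {s} c u → suc s ≡ 2 * c → M ∣ c + u → N ∣ suc (u + u + s)
    divides-double c u eq M∣ = subst (N ∣_) (sym (halved {c = c} u eq)) (*-monoʳ-∣ 2 M∣)

    quotients-unique : ∀ {c} p {g g′ : G} → M ∣ c + val g → M ∣ c + val g′ →
                       χ (val g + p) ≡ χ (val g′ + p) → g ≡ g′
    quotients-unique {c} p {g} {g′} (divides a eqa) (divides b eqb) χ≡ =
      same-parity-unique {c} {a} {b} {g} {g′} eqa eqb (sym (ℙ.+-cancelˡ-≡ (χ (val g + p)) _ _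
        (trans (χ-quotients {c} {a = a} {b} p eqa eqb) (cong (_⊕ parity a) (sym χ≡)))))

    -- Halving the congruence leaves `c + u` divisible by `M`. This fixes `u` only up to adding `M`,
    -- and the label decides between the two solutions.
    double-unique : ∀ {s} p {g g′ : G} → parity s ≡ 1ℙ →
                    N ∣ suc (val g + val g + s) → N ∣ suc (val g′ + val g′ + s) →
                    χ (val g + p) ≡ χ (val g′ + p) → g ≡ g′
    double-unique p {g} {g′} odd N∣ N∣′ =
      let c , eq = odd-predecessor odd in
      quotients-unique {c} p {g} {g′} (double-divides c (val g) eq N∣) (double-divides c (val g′) eq N∣′)

    double-exists : ∀ {s} p l → parity s ≡ 1ℙ →
                    ∃[ g ] N ∣ suc (val {h} g + val g + s) × l ≡ χ (val g + p)
    double-exists {s} p l odd with odd-predecessor odd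
    -- The two solutions are the residues of `-c` and `-c - M`; exactly one of them carries the
    -- label `l`.
    ... | c , eq with solve-residue c | solve-residue (M + c)
    ... | g , divides a eqa | g′ , divides b eqb = choose (l ℙ.≟ χ (val g + p))
      where
      even-multiple : ∀ a M → a * (2 * M) ≡ (2 * a) * M
      even-multiple = solve-∀
      odd-multiple : ∀ a M → M + (2 * a) * M ≡ (1 + 2 * a) * M
      odd-multiple = solve-∀
      quotient-g : M + c + val g ≡ (1 + 2 * a) * M
      quotient-g = trans (ℕ.+-assoc M c _)
        (trans (cong (M +_) (trans eqa (even-multiple a M))) (odd-multiple a M))
      -- Relative to the offset `M + c`, the quotient by `M` is odd for `g` and even for `g′`, so
      -- the labels differ.
      χ-flip : χ (val g′ + p) ≡ χ (val g + p) ⁻¹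
      χ-flip = begin
        χ (val g′ + p)                          ≡⟨ ⁻¹-shift (χ (val g′ + p)) ⟩
        (χ (val g′ + p) ⊕ 1ℙ) ⁻¹                ≡⟨ cong (λ t → (χ (val g′ + p) ⊕ t) ⁻¹) (parity-bit 1ℙ a) ⟨
        (χ (val g′ + p) ⊕ parity (1 + 2 * a)) ⁻¹
          ≡⟨ cong _⁻¹ (χ-quotients {M + c} {a = 1 + 2 * a} {2 * b} p quotient-g
            (trans eqb (even-multiple b M))) ⟨
        (χ (val g + p) ⊕ parity (2 * b)) ⁻¹     ≡⟨ cong (λ t → (χ (val g + p) ⊕ t) ⁻¹) (parity-even b) ⟩
        (χ (val g + p) ⊕ 0ℙ) ⁻¹                 ≡⟨ cong _⁻¹ (ℙ.+-identityʳ _) ⟩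
        χ (val g + p) ⁻¹                        ∎
        where
        open ≡-Reasoning
        ⁻¹-shift : ∀ t → t ≡ (t ⊕ 1ℙ) ⁻¹
        ⁻¹-shift 0ℙ = refl
        ⁻¹-shift 1ℙ = refl
      choose : Dec (l ≡ χ (val g + p)) → ∃[ g ] N ∣ suc (val {h} g + val g + s) × l ≡ χ (val g + p)
      choose (yes l≡) = g , divides-double c (val g) eq (∣-trans (n∣m*n 2) (divides a eqa)) , l≡
      choose (no  l≢) = g′ , divides-double c (val g′) eq M∣c+g′ , trans (≢⇒⁻¹ l≢) (sym χ-flip)
        where
        M∣c+g′ : M ∣ c + val g′
        M∣c+g′ = ∣m+n∣m⇒∣n {m = M}
          (subst (M ∣_) (ℕ.+-assoc M c (val g′)) (∣-trans (n∣m*n 2) (divides b eqb))) ∣-refl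
        ≢⇒⁻¹ : ∀ {s t} → s ≢ t → s ≡ t ⁻¹
        ≢⇒⁻¹ {0ℙ} {0ℙ} s≢t = ⊥-elim (s≢t refl)
        ≢⇒⁻¹ {0ℙ} {1ℙ} s≢t = refl
        ≢⇒⁻¹ {1ℙ} {0ℙ} s≢t = refl
        ≢⇒⁻¹ {1ℙ} {1ℙ} s≢t = ⊥-elim (s≢t refl)

-- The cross blocks

data Point (h : ℕ) : Set where
  ∞          : Parity → Point h
  left right : Residue h → Point h

Side : Set
Side = Parity

Flat : ∀ {h} → Side × Parity → Point h → Set
Flat (s , t) (∞ _)     = ⊤
Flat (s , t) (left g)  = s ≡ 0ℙ × par g ≡ t
Flat (s , t) (right g) = s ≡ 1ℙ × par g ≡ t

-- `D` stands for the inflated 3-BBD on one copy of the residues and is used on both copies. Its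
-- conditions leave to the flats precisely the one-sided triples of constant parity.
module Quads (h : ℕ) .{{_ : NonZero h}} (D : List (Residue h) → Set)
  (D-resp-↭ : ∀ {xs ys} → xs ↭ ys → D xs → D ys)
  (D-mixed : ∀ {w a b c} → D (w ∷ a ∷ b ∷ c ∷ []) → ¬ (par a ≡ par c × par b ≡ par c))
  (D-covers : ∀ {a b c} → Unique (a ∷ b ∷ c ∷ []) → ¬ (par a ≡ par c × par b ≡ par c) →
    ∃[ w ] Fresh w (a ∷ b ∷ c ∷ []) × D (w ∷ a ∷ b ∷ c ∷ []) ×
           (∀ {w′} → D (w′ ∷ a ∷ b ∷ c ∷ []) → w′ ≡ w))
  where

  open Residues h

  private
    G = Residue h
    variable
      l : Parity
      a b u v p q : G
      A B : List G

  Σval : List G → ℕ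
  Σval A = sum (map val A)

  -- The cross block {∞ l, a} ∪ B, the degenerate case {a, a} ∪ B of a zero sum.
  record Tangent (l : Parity) (a : G) (B : List G) : Set where
    constructor tangent
    field
      pair     : length B ≡ 2
      zero-sum : N ∣ suc (val a + val a + Σval B)
      label    : All (λ b → l ≡ χ (val a + val b)) B

  -- The three lists are the points ∞, the left points and the right points of a quad.
  data Q : List Parity → List G → List G → Set where
    onLeft  : D A → Q [] A []
    onRight : D B → Q [] [] B
    cross   : length A ≡ 2 → length B ≡ 2 → N ∣ suc (Σval A + Σval B) → Q [] A B
    ∞left   : Tangent l a B → Q (l ∷ []) (a ∷ []) B
    -- Inverting the label makes the two kinds of ∞ block complementary: for `u` on the left and `p`
    -- on the right, exactly one of `l ≡ χ (u + p)` and `l ⁻¹ ≡ χ (p + u)` holds.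
    ∞right  : Tangent (l ⁻¹) b A → Q (l ∷ []) A (b ∷ [])

  Σval-↭ : A ↭ B → Σval A ≡ Σval B
  Σval-↭ σ = sum-↭ (map⁺ val σ)

  Tangent-resp-↭ : A ↭ B → Tangent l a A → Tangent l a B
  Tangent-resp-↭ {a = a} σ (tangent len N∣ χs) = tangent (trans (sym (↭-length σ)) len)
    (subst (λ s → N ∣ suc (val a + val a + s)) (Σval-↭ σ) N∣) (All-resp-↭ σ χs)

  Q-resp-↭ : ∀ {I I′ A A′ B B′} → I ↭ I′ → A ↭ A′ → B ↭ B′ → Q I A B → Q I′ A′ B′
  Q-resp-↭ ι α β (onLeft d) with refl ← ↭-empty-inv (↭-sym ι) | refl ← ↭-empty-inv (↭-sym β) =
    onLeft (D-resp-↭ α d)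
  Q-resp-↭ ι α β (onRight d) with refl ← ↭-empty-inv (↭-sym ι) | refl ← ↭-empty-inv (↭-sym α) =
    onRight (D-resp-↭ β d)
  Q-resp-↭ ι α β (cross lenA lenB N∣) with refl ← ↭-empty-inv (↭-sym ι) =
    cross (trans (sym (↭-length α)) lenA) (trans (sym (↭-length β)) lenB)
      (subst (N ∣_) (cong₂ (λ s t → suc (s + t)) (Σval-↭ α) (Σval-↭ β)) N∣)
  Q-resp-↭ ι α β (∞left t) with refl ← ↭-singleton-inv (↭-sym ι) | refl ← ↭-singleton-inv (↭-sym α) =
    ∞left (Tangent-resp-↭ β t)
  Q-resp-↭ ι α β (∞right t) with refl ← ↭-singleton-inv (↭-sym ι) | refl ← ↭-singleton-inv (↭-sym β) =
    ∞right (Tangent-resp-↭ α t)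

  ∞? : Point h → Maybe Parity
  ∞? (∞ l) = just l
  ∞? _     = nothing

  left? right? : Point h → Maybe G
  left? (left g) = just g
  left? _        = nothing
  right? (right g) = just g
  right? _         = nothing

  -- Sorting the points by kind reduces invariance under permutation to the three sublists, and lets
  -- pattern matching on `Q` exclude most kinds of completion.
  R : List (Point h) → Set
  R xs = Q (mapMaybe ∞? xs) (mapMaybe left? xs) (mapMaybe right? xs)

  R-resp-↭ : ∀ {xs ys} → xs ↭ ys → R xs → R ys
  R-resp-↭ σ = Q-resp-↭ (mapMaybe-↭ ∞? σ) (mapMaybe-↭ left? σ) (mapMaybe-↭ right? σ)

  open Assembly {Point h} Flat R

  opaque
    2Σ : ∀ a b → a + (b + 0) ≡ a + b
    2Σ = solve-∀

    Σval-odd : par p ≢ par q → parity (Σval (p ∷ q ∷ [])) ≡ 1ℙ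
    Σval-odd {p} {q} p≢q = trans (cong parity (2Σ (val p) (val q))) (trans (ℙ.+-homo-+ (val p) (val q))
        (trans (cong₂ _⊕_ (parity-val p) (parity-val q)) (differ (par p) (par q) p≢q)))
      where
      differ : ∀ s t → s ≢ t → s ⊕ t ≡ 1ℙ
      differ 0ℙ 0ℙ s≢t = ⊥-elim (s≢t refl)
      differ 0ℙ 1ℙ s≢t = refl
      differ 1ℙ 0ℙ s≢t = refl
      differ 1ℙ 1ℙ s≢t = ⊥-elim (s≢t refl)

    -- As `N` is even, the zero sum modulo 2 reads p + q + 1 = 0. Hence no ∞ block contains a triple
    -- of a flat, and its two points on the same side are distinct.
    tangent-parity : Tangent l a (p ∷ q ∷ []) → par p ≢ par q
    tangent-parity {a = a} {p} {q} (tangent _ N∣ _) p≡q =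
      contradiction (trans (sym (odd-parity N∣)) even) λ ()
      where
      even : parity (val a + val a + Σval (p ∷ q ∷ [])) ≡ 0ℙ
      even = begin
        parity (val a + val a + Σval (p ∷ q ∷ []))    ≡⟨ ℙ.+-homo-+ (val a + val a) _ ⟩
        parity (val a + val a) ⊕ parity (Σval (p ∷ q ∷ []))
          ≡⟨ cong₂ _⊕_ (ℙ.+-homo-+ (val a) (val a)) (cong parity (2Σ (val p) (val q))) ⟩
        parity (val a) ⊕ parity (val a) ⊕ parity (val p + val q)
          ≡⟨ cong₂ _⊕_ (ℙ.p+p≡0ℙ (parity (val a))) (ℙ.+-homo-+ (val p) (val q)) ⟩
        parity (val p) ⊕ parity (val q)               ≡⟨ cong₂ _⊕_ (trans (parity-val p) p≡q) (parity-val q) ⟩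
        par q ⊕ par q                                 ≡⟨ ℙ.p+p≡0ℙ (par q) ⟩
        0ℙ                                            ∎
        where open ≡-Reasoning

    -- The zero sum regroups as `(a + q) + (a + p) + 1`, so `χ-reflect` applies: the label may be
    -- computed from either point.
    zero-sum⇒label : ∀ (a p q : G) → N ∣ suc (val a + val a + Σval (q ∷ p ∷ [])) →
                     χ (val a + val q) ≡ χ (val a + val p)
    zero-sum⇒label a p q N∣ =
      χ-reflect _ _ (subst (N ∣_) (cong suc (rearrange (val a) (val q) (val p))) N∣)
      where
      rearrange : ∀ a q p → a + a + (q + (p + 0)) ≡ a + q + (a + p)
      rearrange = solve-∀

    mk-tangent : ∀ {l a p q} → N ∣ suc (val a + val a + Σval (q ∷ p ∷ [])) → l ≡ χ (val a + val p) →
                 Tangent l a (q ∷ p ∷ [])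
    mk-tangent {l} {a} {p} {q} N∣ l≡ =
      tangent refl N∣ (trans l≡ (sym (zero-sum⇒label a p q N∣)) ∷ l≡ ∷ [])

    tangent-exists : ∀ l → par p ≢ par q → ∃[ a ] Tangent l a (p ∷ q ∷ [])
    tangent-exists {p} {q} l p≢q with double-exists (val q) l (Σval-odd {p} {q} p≢q)
    ... | a , N∣ , l≡ = a , mk-tangent N∣ l≡

    tangent-unique : Tangent l a (p ∷ q ∷ []) → Tangent l b (p ∷ q ∷ []) → a ≡ b
    tangent-unique {p = p} {q} t@(tangent _ N∣ (_ ∷ l≡ ∷ _)) (tangent _ N∣′ (_ ∷ l≡′ ∷ _)) =
      double-unique (val q) (Σval-odd {p} {q} (tangent-parity t)) N∣ N∣′ (trans (sym l≡) l≡′)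

    rearrange-tangent : ∀ a p q → suc (a + a + (q + (p + 0))) ≡ suc (a + a + p) + q
    rearrange-tangent = solve-∀

    -- The zero sum is linear in `q`, and reflection then gives `q` the label of `p`.
    complete-tangent : ∀ a p → l ≡ χ (val a + val p) → ∃[ q ] Tangent l a (q ∷ p ∷ [])
    complete-tangent a p l≡ with solve-residue (suc (val a + val a + val p))
    ... | q , N∣ = q , mk-tangent (subst (N ∣_) (sym (rearrange-tangent (val a) (val p) (val q))) N∣) l≡

    complete-unique : ∀ {l′ q q′} → Tangent l a (q ∷ p ∷ []) → Tangent l′ a (q′ ∷ p ∷ []) → q ≡ q′
    complete-unique {a = a} {p} {q = q} {q′} (tangent _ N∣ _) (tangent _ N∣′ _) =
      residue-unique (suc (val a + val a + val p))
        (subst (N ∣_) (rearrange-tangent (val a) (val p) (val q)) N∣)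
        (subst (N ∣_) (rearrange-tangent (val a) (val p) (val q′)) N∣′)

  -- Completion of a triple, by the kinds of its points

  two∞ : ∀ {k l z} → Covered (∞ k ∷ ∞ l ∷ z ∷ [])
  -- The point `w` is moved behind the two points ∞, so that the first index of `Q` visibly has two
  -- entries, which no constructor allows.
  two∞ {k} {l} {z} = inFlat (_ , tt ∷ tt ∷ proj₂ (some-flat z) ∷ []) λ {w} _ r → absurd {w}
      (R-resp-↭ {w ∷ ∞ k ∷ ∞ l ∷ z ∷ []}
        (↭-trans (swap w (∞ k) ↭-refl) (prep (∞ k) (swap w (∞ l) ↭-refl))) r)
    where
    some-flat : ∀ z → ∃[ i ] Flat i z
    some-flat (∞ _)     = (0ℙ , 0ℙ) , tt
    some-flat (left g)  = (0ℙ , par g) , refl , refl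
    some-flat (right g) = (1ℙ , par g) , refl , refl
    absurd : ∀ {w} → ¬ R (∞ k ∷ ∞ l ∷ w ∷ z ∷ [])
    absurd ()

  ∞LL : Covered (∞ l ∷ left u ∷ left v ∷ [])
  ∞LL {l} {u} {v} with par u ℙ.≟ par v
  ... | yes u≡v = inFlat ((0ℙ , par v) , tt ∷ (refl , u≡v) ∷ (refl , refl) ∷ []) λ {w} _ r → absurd w r
    where
    absurd : ∀ w → ¬ R (w ∷ ∞ l ∷ left u ∷ left v ∷ [])
    absurd (right _) (∞right t) = tangent-parity t u≡v
  ... | no u≢v with tangent-exists {u} {v} (l ⁻¹) u≢v
  ... | a , t = offFlat (right a) (λ { (i , _ ∷ (_ , eu) ∷ (_ , ev) ∷ []) → u≢v (trans eu (sym ev)) })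
      ((λ ()) ∷ (λ ()) ∷ (λ ()) ∷ []) (∞right t) (λ {w′} _ → unique w′)
    where
    unique : ∀ w → R (w ∷ ∞ l ∷ left u ∷ left v ∷ []) → w ≡ right a
    unique (right _) (∞right t′) = cong right (tangent-unique t′ t)

  ∞RR : Covered (∞ l ∷ right u ∷ right v ∷ [])
  ∞RR {l} {u} {v} with par u ℙ.≟ par v
  ... | yes u≡v = inFlat ((1ℙ , par v) , tt ∷ (refl , u≡v) ∷ (refl , refl) ∷ []) λ {w} _ r → absurd w r
    where
    absurd : ∀ w → ¬ R (w ∷ ∞ l ∷ right u ∷ right v ∷ [])
    absurd (left _) (∞left t) = tangent-parity t u≡v
  ... | no u≢v with tangent-exists {u} {v} l u≢v
  ... | a , t = offFlat (left a) (λ { (i , _ ∷ (_ , eu) ∷ (_ , ev) ∷ []) → u≢v (trans eu (sym ev)) })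
      ((λ ()) ∷ (λ ()) ∷ (λ ()) ∷ []) (∞left t) (λ {w′} _ → unique w′)
    where
    unique : ∀ w → R (w ∷ ∞ l ∷ right u ∷ right v ∷ []) → w ≡ left a
    unique (left _) (∞left t′) = cong left (tangent-unique t′ t)

  label : Tangent l a (p ∷ q ∷ []) → l ≡ χ (val a + val q)
  label (tangent _ _ (_ ∷ l≡ ∷ [])) = l≡

  private
    sides-differ : ∀ {s} → s ≡ 0ℙ → ¬ s ≡ 1ℙ
    sides-differ refl ()

    ⁻¹-≢ : ∀ {s t} → s ≢ t → s ⁻¹ ≡ t
    ⁻¹-≢ {0ℙ} {0ℙ} s≢t = ⊥-elim (s≢t refl)
    ⁻¹-≢ {0ℙ} {1ℙ} s≢t = refl
    ⁻¹-≢ {1ℙ} {0ℙ} s≢t = refl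
    ⁻¹-≢ {1ℙ} {1ℙ} s≢t = ⊥-elim (s≢t refl)

  -- The label test decides on which side the fourth point lies; the inverted label in `∞right`
  -- prevents a second completion on the other side.
  ∞LR : Covered (∞ l ∷ left u ∷ right p ∷ [])
  ∞LR {l} {u} {p} with l ℙ.≟ χ (val u + val p)
  ... | yes l≡ with complete-tangent u p l≡
  ... | q , t = offFlat (right q) (λ { (i , _ ∷ (s≡ , _) ∷ (s≡′ , _) ∷ []) → sides-differ s≡ s≡′ })
      ((λ ()) ∷ (λ ()) ∷ (λ { refl → tangent-parity t refl }) ∷ []) (∞left t) (λ {w′} _ → unique w′)
    where
    unique : ∀ w → R (w ∷ ∞ l ∷ left u ∷ right p ∷ []) → w ≡ right q
    unique (left _)  (∞right t′) = ⊥-elim (ℙ.p≢p⁻¹ l (trans l≡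
      (trans (cong χ (ℕ.+-comm (val u) (val p))) (sym (label t′)))))
    unique (right _) (∞left t′)  = cong right (complete-unique t′ t)
  ∞LR {l} {u} {p} | no l≢ with complete-tangent p u (trans (⁻¹-≢ l≢) (cong χ (ℕ.+-comm (val u) (val p))))
  ... | q , t = offFlat (left q) (λ { (i , _ ∷ (s≡ , _) ∷ (s≡′ , _) ∷ []) → sides-differ s≡ s≡′ })
      ((λ ()) ∷ (λ { refl → tangent-parity t refl }) ∷ (λ ()) ∷ []) (∞right t) (λ {w′} _ → unique w′)
    where
    unique : ∀ w → R (w ∷ ∞ l ∷ left u ∷ right p ∷ []) → w ≡ left q
    unique (left _)  (∞right t′) = cong left (complete-unique t′ t)
    unique (right _) (∞left t′)  = ⊥-elim (l≢ (label t′))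

  opaque
    rearrange-cross : ∀ u v p q → suc (u + (v + 0) + (q + (p + 0))) ≡ suc (u + v + p) + q
    rearrange-cross = solve-∀
    rearrange-cross′ : ∀ u v p q → suc (q + (p + 0) + (u + (v + 0))) ≡ suc (u + v + p) + q
    rearrange-cross′ = solve-∀
    rearrange-double : ∀ u v p → suc (p + p + (u + (v + 0))) ≡ suc (u + v + p) + p
    rearrange-double = solve-∀

    tangent-double : Tangent l p (u ∷ v ∷ []) → N ∣ suc (val u + val v + val p) + val p
    tangent-double {p = p} {u} {v} (tangent _ N∣ _) =
      subst (N ∣_) (rearrange-double (val u) (val v) (val p)) N∣

    double-tangent : N ∣ suc (val u + val v + val p) + val p → Tangent (χ (val p + val v)) p (u ∷ v ∷ [])
    double-tangent {u} {v} {p} N∣ =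
      mk-tangent (subst (N ∣_) (sym (rearrange-double (val u) (val v) (val p))) N∣) refl

  -- The equation u + v + p + q + 1 = 0 has one solution `q`. It completes the triple unless it
  -- repeats `p`; then a point ∞ takes its place.
  LLR : Covered (left u ∷ left v ∷ right p ∷ [])
  LLR {u} {v} {p} with solve-residue (suc (val u + val v + val p))
  ... | q , N∣ with val q ℕ.≟ val p
  ... | no q≢p = offFlat (right q) (λ { (i , _ ∷ (s≡ , _) ∷ (s≡′ , _) ∷ []) → sides-differ s≡ s≡′ })
      ((λ ()) ∷ (λ ()) ∷ (λ { refl → q≢p refl }) ∷ [])
      (cross refl refl (subst (N ∣_) (sym (rearrange-cross (val u) (val v) (val p) (val q))) N∣))
      (λ {w′} _ → unique w′)
    where
    unique : ∀ w → R (w ∷ left u ∷ left v ∷ right p ∷ []) → w ≡ right q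
    unique (right q′) (cross _ _ N∣′) = cong right (residue-unique (suc (val u + val v + val p))
      (subst (N ∣_) (rearrange-cross (val u) (val v) (val p) (val q′)) N∣′) N∣)
    unique (left _) (cross () _ _)
    -- An ∞ block through the triple says that `p` itself solves the equation for `q`.
    unique (∞ _) (∞right t) = ⊥-elim (q≢p (cong val {q} {p}
      (residue-unique (suc (val u + val v + val p)) N∣ (tangent-double {u = u} {v} t))))
  ... | yes q≡p with refl ← val-injective {q} {p} q≡p =
      offFlat (∞ (χ (val p + val v) ⁻¹))
      (λ { (i , _ ∷ (s≡ , _) ∷ (s≡′ , _) ∷ []) → sides-differ s≡ s≡′ })
      ((λ ()) ∷ (λ ()) ∷ (λ ()) ∷ [])
      (∞right (subst (λ l → Tangent l p (u ∷ v ∷ [])) (sym (ℙ.⁻¹-involutive _))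
        (double-tangent {u} {v} {p} N∣)))
      (λ {w′} → unique w′)
    where
    unique : ∀ w → Fresh w (left u ∷ left v ∷ right p ∷ []) → R (w ∷ left u ∷ left v ∷ right p ∷ []) →
             w ≡ ∞ (χ (val p + val v) ⁻¹)
    -- Freshness matters here: `q′ = p` satisfies the equation of a `cross` list but repeats a
    -- point.
    unique (right q′) (_ ∷ _ ∷ q′≢p ∷ []) (cross _ _ N∣′) = ⊥-elim (q′≢p (cong right
      (residue-unique (suc (val u + val v + val p))
        (subst (N ∣_) (rearrange-cross (val u) (val v) (val p) (val q′)) N∣′) N∣)))
    unique (left _) _ (cross () _ _)
    unique (∞ l) _ (∞right t) = cong ∞ (trans (sym (ℙ.⁻¹-involutive l)) (cong _⁻¹ (label t)))

  LRR : Covered (left p ∷ right u ∷ right v ∷ [])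
  LRR {p} {u} {v} with solve-residue (suc (val u + val v + val p))
  ... | q , N∣ with val q ℕ.≟ val p
  ... | no q≢p = offFlat (left q) (λ { (i , (s≡ , _) ∷ (s≡′ , _) ∷ _ ∷ []) → sides-differ s≡ s≡′ })
      ((λ { refl → q≢p refl }) ∷ (λ ()) ∷ (λ ()) ∷ [])
      (cross refl refl (subst (N ∣_) (sym (rearrange-cross′ (val u) (val v) (val p) (val q))) N∣))
      (λ {w′} _ → unique w′)
    where
    unique : ∀ w → R (w ∷ left p ∷ right u ∷ right v ∷ []) → w ≡ left q
    unique (left q′) (cross _ _ N∣′) = cong left (residue-unique (suc (val u + val v + val p))
      (subst (N ∣_) (rearrange-cross′ (val u) (val v) (val p) (val q′)) N∣′) N∣)
    unique (right _) (cross () _ _)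
    unique (∞ _) (∞left t) = ⊥-elim (q≢p (cong val {q} {p}
      (residue-unique (suc (val u + val v + val p)) N∣ (tangent-double {u = u} {v} t))))
  ... | yes q≡p with refl ← val-injective {q} {p} q≡p =
      offFlat (∞ (χ (val p + val v)))
      (λ { (i , (s≡ , _) ∷ (s≡′ , _) ∷ _ ∷ []) → sides-differ s≡ s≡′ })
      ((λ ()) ∷ (λ ()) ∷ (λ ()) ∷ [])
      (∞left (double-tangent {u} {v} {p} N∣))
      (λ {w′} → unique w′)
    where
    unique : ∀ w → Fresh w (left p ∷ right u ∷ right v ∷ []) → R (w ∷ left p ∷ right u ∷ right v ∷ []) →
             w ≡ ∞ (χ (val p + val v))
    unique (left q′) (q′≢p ∷ _) (cross _ _ N∣′) = ⊥-elim (q′≢p (cong left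
      (residue-unique (suc (val u + val v + val p))
        (subst (N ∣_) (rearrange-cross′ (val u) (val v) (val p) (val q′)) N∣′) N∣)))
    unique (right _) _ (cross () _ _)
    unique (∞ l) _ (∞left t) = cong ∞ (label t)

  LLL : Unique (left a ∷ left b ∷ left p ∷ []) → Covered (left a ∷ left b ∷ left p ∷ [])
  LLL {a} {b} {c} u with (par a ℙ.≟ par c) ×-dec (par b ℙ.≟ par c)
  ... | yes (a≡c , b≡c) = inFlat ((0ℙ , par c) , (refl , a≡c) ∷ (refl , b≡c) ∷ (refl , refl) ∷ [])
      λ {w} _ r → absurd w r
    where
    absurd : ∀ w → ¬ R (w ∷ left a ∷ left b ∷ left c ∷ [])
    absurd (left _) (onLeft d) = D-mixed d (a≡c , b≡c)
    absurd (left _) (cross () _ _)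
    absurd (right _) (cross () _ _)
  ... | no mixed with D-covers {a} {b} {c} (Unique.map⁻ u) mixed
  ... | w , fresh , d , uniq = offFlat (left w)
      (λ { (i , (_ , ea) ∷ (_ , eb) ∷ (_ , ec) ∷ []) → mixed (trans ea (sym ec) , trans eb (sym ec)) })
      (All.map⁺ (All.map (λ { w≢ refl → w≢ refl }) fresh)) (onLeft d) (λ {w′} _ → unique w′)
    where
    unique : ∀ w′ → R (w′ ∷ left a ∷ left b ∷ left c ∷ []) → w′ ≡ left w
    unique (left _) (onLeft d′) = cong left (uniq d′)
    unique (left _) (cross () _ _)
    unique (right _) (cross () _ _)

  RRR : Unique (right a ∷ right b ∷ right p ∷ []) → Covered (right a ∷ right b ∷ right p ∷ [])
  RRR {a} {b} {c} u with (par a ℙ.≟ par c) ×-dec (par b ℙ.≟ par c)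
  ... | yes (a≡c , b≡c) = inFlat ((1ℙ , par c) , (refl , a≡c) ∷ (refl , b≡c) ∷ (refl , refl) ∷ [])
      λ {w} _ r → absurd w r
    where
    absurd : ∀ w → ¬ R (w ∷ right a ∷ right b ∷ right c ∷ [])
    absurd (right _) (onRight d) = D-mixed d (a≡c , b≡c)
    absurd (right _) (cross () _ _)
    absurd (left _) (cross _ () _)
  ... | no mixed with D-covers {a} {b} {c} (Unique.map⁻ u) mixed
  ... | w , fresh , d , uniq = offFlat (right w)
      (λ { (i , (_ , ea) ∷ (_ , eb) ∷ (_ , ec) ∷ []) → mixed (trans ea (sym ec) , trans eb (sym ec)) })
      (All.map⁺ (All.map (λ { w≢ refl → w≢ refl }) fresh)) (onRight d) (λ {w′} _ → unique w′)
    where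
    unique : ∀ w′ → R (w′ ∷ right a ∷ right b ∷ right c ∷ []) → w′ ≡ right w
    unique (right _) (onRight d′) = cong right (uniq d′)
    unique (right _) (cross () _ _)
    unique (left _) (cross _ () _)

  reorder : ∀ {ts us} → ts ↭ us → (Unique ts → Covered ts) → Unique us → Covered us
  reorder σ covered u = Covered-resp-↭ R-resp-↭ σ (covered (Unique-resp-↭ (↭-sym σ) u))

  private
    flip₁₂ : ∀ {x y z : Point h} → x ∷ y ∷ z ∷ [] ↭ y ∷ x ∷ z ∷ []
    flip₁₂ = swap _ _ ↭-refl
    flip₂₃ : ∀ {x y z : Point h} → x ∷ y ∷ z ∷ [] ↭ x ∷ z ∷ y ∷ []
    flip₂₃ = prep _ (swap _ _ ↭-refl)
    rotʳ : ∀ {x y z : Point h} → x ∷ y ∷ z ∷ [] ↭ y ∷ z ∷ x ∷ []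
    rotʳ = ↭-trans flip₁₂ flip₂₃
    rotˡ : ∀ {x y z : Point h} → x ∷ y ∷ z ∷ [] ↭ z ∷ x ∷ y ∷ []
    rotˡ = ↭-trans flip₂₃ flip₁₂
    reverse₃ : ∀ {x y z : Point h} → x ∷ y ∷ z ∷ [] ↭ z ∷ y ∷ x ∷ []
    reverse₃ = ↭-trans flip₁₂ rotˡ

  -- Up to order there are eight kinds of triple; the remaining clauses are permuted into one of
  -- them.
  cover₃ : ∀ x y z → Unique (x ∷ y ∷ z ∷ []) → Covered (x ∷ y ∷ z ∷ [])
  cover₃ (∞ _)     (∞ _)     _         = λ _ → two∞
  cover₃ (∞ _)     (left _)  (∞ _)     = reorder flip₂₃ λ _ → two∞
  cover₃ (∞ _)     (right _) (∞ _)     = reorder flip₂₃ λ _ → two∞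
  cover₃ (left _)  (∞ _)     (∞ _)     = reorder rotˡ λ _ → two∞
  cover₃ (right _) (∞ _)     (∞ _)     = reorder rotˡ λ _ → two∞
  cover₃ (∞ _)     (left _)  (left _)  = λ _ → ∞LL
  cover₃ (left _)  (∞ _)     (left _)  = reorder flip₁₂ λ _ → ∞LL
  cover₃ (left _)  (left _)  (∞ _)     = reorder rotʳ λ _ → ∞LL
  cover₃ (∞ _)     (right _) (right _) = λ _ → ∞RR
  cover₃ (right _) (∞ _)     (right _) = reorder flip₁₂ λ _ → ∞RR
  cover₃ (right _) (right _) (∞ _)     = reorder rotʳ λ _ → ∞RR
  cover₃ (∞ _)     (left _)  (right _) = λ _ → ∞LR
  cover₃ (∞ _)     (right _) (left _)  = reorder flip₂₃ λ _ → ∞LR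
  cover₃ (left _)  (∞ _)     (right _) = reorder flip₁₂ λ _ → ∞LR
  cover₃ (right _) (∞ _)     (left _)  = reorder rotˡ λ _ → ∞LR
  cover₃ (left _)  (right _) (∞ _)     = reorder rotʳ λ _ → ∞LR
  cover₃ (right _) (left _)  (∞ _)     = reorder reverse₃ λ _ → ∞LR
  cover₃ (left _)  (left _)  (left _)  = LLL
  cover₃ (left _)  (left _)  (right _) = λ _ → LLR
  cover₃ (left _)  (right _) (left _)  = reorder flip₂₃ λ _ → LLR
  cover₃ (right _) (left _)  (left _)  = reorder rotˡ λ _ → LLR
  cover₃ (left _)  (right _) (right _) = λ _ → LRR
  cover₃ (right _) (left _)  (right _) = reorder flip₁₂ λ _ → LRR
  cover₃ (right _) (right _) (left _)  = reorder rotʳ λ _ → LRR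
  cover₃ (right _) (right _) (right _) = RRR

  cover : ∀ {ts} → Unique ts → length ts ≡ 3 → Covered ts
  cover {x ∷ y ∷ z ∷ []} u _ = cover₃ x y z u

-- Replacing each point of a 3-BBD by four

Σℙ : List Parity → Parity
Σℙ = foldr _⊕_ 0ℙ

Σℙ-↭ : ∀ {ss ts} → ss ↭ ts → Σℙ ss ≡ Σℙ ts
Σℙ-↭ refl         = refl
Σℙ-↭ (prep s σ)   = cong (s ⊕_) (Σℙ-↭ σ)
Σℙ-↭ (swap s t σ) = trans (cong (λ x → s ⊕ (t ⊕ x)) (Σℙ-↭ σ))
  (trans (sym (ℙ.+-assoc s t _)) (trans (cong (_⊕ _) (ℙ.+-comm s t)) (ℙ.+-assoc t s _)))
Σℙ-↭ (_↭_.trans σ τ)  = trans (Σℙ-↭ σ) (Σℙ-↭ τ)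

module _ {A : Set} where

  two-pairs : ∀ {a e f : A} {xs} → a ∷ xs ↭ e ∷ e ∷ f ∷ f ∷ [] →
              ∃[ g ] xs ↭ a ∷ g ∷ g ∷ []
  two-pairs {a} {e} {f} σ with ∈-resp-↭ σ (here refl)
  ... | here refl                        = f , drop-∷ σ
  ... | there (here refl)                = f , drop-∷ σ
  ... | there (there (here refl))        =
    e , drop-∷ (↭-trans σ (++-comm (e ∷ e ∷ []) _))
  ... | there (there (there (here refl))) =
    e , drop-∷ (↭-trans σ (++-comm (e ∷ e ∷ []) _))

  paired : ∀ {a b c e f : A} → a ∷ a ∷ b ∷ c ∷ [] ↭ e ∷ e ∷ f ∷ f ∷ [] → b ≡ c
  paired σ with two-pairs σ
  ... | g , τ with b≡g ∷ c≡g ∷ [] ← All-resp-↭ {P = _≡ g} (↭-sym (drop-∷ τ)) (refl ∷ refl ∷ []) =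
    trans b≡g (sym c≡g)

  -- The values of `s` separate `c` from `a` and `b`. So `c` is not in the pair of `a`, only `a` can
  -- be the partner of `b`, and `d` is left as the partner of `c`.
  paired-split : ∀ {a b c d e f : A} (s : A → Parity) → d ∷ a ∷ b ∷ c ∷ [] ↭ e ∷ e ∷ f ∷ f ∷ [] →
                 s a ≡ s b → s b ≢ s c → a ≡ b × d ≡ c
  paired-split {a} {b} {c} {d} s σ a∼b b≁c with two-pairs (↭-trans (swap a d ↭-refl) σ)
  ... | g , τ = split (All-resp-↭ (↭-sym τ) (inj₁ refl ∷ inj₂ refl ∷ inj₂ refl ∷ [])) τ
    where
    split : All (λ x → x ≡ a ⊎ x ≡ g) (d ∷ b ∷ c ∷ []) → d ∷ b ∷ c ∷ [] ↭ a ∷ g ∷ g ∷ [] → a ≡ b × d ≡ c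
    split (_ ∷ inj₁ refl ∷ inj₂ refl ∷ []) τ′
      with refl ← ↭-singleton-inv (drop-∷ (drop-∷ (↭-trans (++-comm (b ∷ c ∷ []) (d ∷ [])) τ′)))
      = refl , refl
    split (_ ∷ inj₁ refl ∷ inj₁ refl ∷ []) _ = ⊥-elim (b≁c refl)
    split (_ ∷ inj₂ refl ∷ inj₁ refl ∷ []) _ = ⊥-elim (b≁c (sym a∼b))
    split (_ ∷ inj₂ refl ∷ inj₂ refl ∷ []) _ = ⊥-elim (b≁c refl)

module Inflation {n} (B : 3-BBD n) (side : Fin n → Parity)
  (side-g₁ : ∀ {i} → side i ≡ 0ℙ → i ∈ 3-BBD.g₁ B)
  (side-g₂ : ∀ {i} → side i ≡ 1ℙ → i ∈ 3-BBD.g₂ B) where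

  private
    module B = 3-BBD B
    variable
      a b c d w : Fin n
      xs ys : List (Fin n)

  -- The projections of quads to the points of `B`, as multisets. The lists in `pairs` serve the
  -- triples in which two points lie over the same point of `B`.
  data B⁺ (xs : List (Fin n)) : Set where
    block : Unique xs → B.Block (set xs) → B⁺ xs
    pairs : ∀ {a c} → side a ≢ side c → xs ↭ a ∷ a ∷ c ∷ c ∷ [] → B⁺ xs

  B⁺-resp-↭ : xs ↭ ys → B⁺ xs → B⁺ ys
  B⁺-resp-↭ σ (block u b)   = block (Unique-resp-↭ σ u) (subst B.Block (set-↭ σ) b)
  B⁺-resp-↭ σ (pairs a≁c τ) = pairs a≁c (↭-trans (↭-sym σ) τ)

  private
    3≰2 : ¬ 3 ≤ 2
    3≰2 (s≤s (s≤s ()))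

  block-mixed : Unique (a ∷ b ∷ c ∷ []) → B.Block (set (w ∷ a ∷ b ∷ c ∷ [])) →
                ¬ All (λ i → side i ≡ side c) (a ∷ b ∷ c ∷ [])
  block-mixed {a} {b} {c} {w} u Blk same = overfull (side c) refl
    where
    3≤ : ∀ {g} → (∀ {i} → i ∈ₗ a ∷ b ∷ c ∷ [] → i ∈ g) → 3 ≤ ∣ set (w ∷ a ∷ b ∷ c ∷ []) ∩ g ∣
    3≤ abc⊆g = length≤∣∣ u λ x∈ → x∈p∩q⁺ (∈-set⁺ {xs = w ∷ a ∷ b ∷ c ∷ []} (there x∈) , abc⊆g x∈)
    overfull : ∀ s → side c ≢ s
    overfull 0ℙ c∼ = 3≰2 (subst (3 ≤_) (proj₁ (B.balanced Blk))
      (3≤ λ x∈ → side-g₁ (trans (All.lookup same x∈) c∼)))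
    overfull 1ℙ c∼ = 3≰2 (subst (3 ≤_) (proj₂ (B.balanced Blk))
      (3≤ λ x∈ → side-g₂ (trans (All.lookup same x∈) c∼)))

  B⁺-mixed : B⁺ (w ∷ a ∷ b ∷ c ∷ []) → ¬ (side a ≡ side c × side b ≡ side c)
  B⁺-mixed (block (_ ∷ u) Blk) (a∼c , b∼c) = block-mixed u Blk (a∼c ∷ b∼c ∷ refl ∷ [])
  B⁺-mixed {w} {a} {b} {c} (pairs {e} {f} e≁f σ) (a∼c , b∼c) =
      -- Both sums count the entries on side `1ℙ`. Two pairs from opposite sides give 2, while three
      -- entries on one side and a fourth entry give 0, 1, 3 or 4.
      unbalanced (side w) (side c) (side e) (side f) e≁f (trans
        (cong₂ (λ s t → bit (side w) + (bit s + (bit t + (bit (side c) + 0)))) (sym a∼c) (sym b∼c))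
        (sum-↭ (map⁺ (bit ∘ side) σ)))
    where
    unbalanced : ∀ s t e f → e ≢ f →
                 bit s + (bit t + (bit t + (bit t + 0))) ≢ bit e + (bit e + (bit f + (bit f + 0)))
    unbalanced s    t    0ℙ 0ℙ e≢f _ = e≢f refl
    unbalanced s    t    1ℙ 1ℙ e≢f _ = e≢f refl
    unbalanced 0ℙ 0ℙ 0ℙ 1ℙ _ ()
    unbalanced 0ℙ 1ℙ 0ℙ 1ℙ _ ()
    unbalanced 1ℙ 0ℙ 0ℙ 1ℙ _ ()
    unbalanced 1ℙ 1ℙ 0ℙ 1ℙ _ ()
    unbalanced 0ℙ 0ℙ 1ℙ 0ℙ _ ()
    unbalanced 0ℙ 1ℙ 1ℙ 0ℙ _ ()
    unbalanced 1ℙ 0ℙ 1ℙ 0ℙ _ ()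
    unbalanced 1ℙ 1ℙ 1ℙ 0ℙ _ ()

  Completion : List (Fin n) → Set
  Completion ts = ∃[ d ] B⁺ (d ∷ ts) × (∀ {d′} → B⁺ (d′ ∷ ts) → d′ ≡ d)

  Completion-resp-↭ : xs ↭ ys → Completion xs → Completion ys
  Completion-resp-↭ σ (d , B⁺d , uniq) =
    d , B⁺-resp-↭ (prep d σ) B⁺d , λ B⁺d′ → uniq (B⁺-resp-↭ (prep _ (↭-sym σ)) B⁺d′)

  complete-pair : side a ≢ side c → Completion (a ∷ a ∷ c ∷ [])
  complete-pair {a} {c} a≁c = c , pairs a≁c (++-comm (c ∷ []) (a ∷ a ∷ c ∷ [])) , unique
    where
    unique : ∀ {d} → B⁺ (d ∷ a ∷ a ∷ c ∷ []) → d ≡ c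
    unique (block (_ ∷ (a≢a ∷ _) ∷ _) _) = ⊥-elim (a≢a refl)
    unique (pairs _ σ) = proj₂ (paired-split side σ refl a≁c)

  -- The block of `B` through the three points supplies the fourth. A competing `pairs` list would
  -- force `a ≡ b` by `paired-split`.
  complete-distinct : a ≢ b → side a ≡ side b → side b ≢ side c → Completion (a ∷ b ∷ c ∷ [])
  complete-distinct {a} {b} {c} a≢b a∼b b≁c = complete (meets (side b) (side c) refl refl b≁c)
    where
    abc : List (Fin n)
    abc = a ∷ b ∷ c ∷ []
    u : Unique abc
    u = (a≢b ∷ (λ { refl → b≁c (sym a∼b) }) ∷ []) ∷ ((λ { refl → b≁c refl }) ∷ []) ∷ [] ∷ []
    Mixed : Set
    Mixed = Nonempty (set abc ∩ B.g₁) × Nonempty (set abc ∩ B.g₂)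
    b∈ : b ∈ set abc
    b∈ = ∈-set⁺ {xs = abc} (there (here refl))
    c∈ : c ∈ set abc
    c∈ = ∈-set⁺ {xs = abc} (there (there (here refl)))
    meets : ∀ s t → side b ≡ s → side c ≡ t → s ≢ t → Mixed
    meets 0ℙ 1ℙ b∼ c∼ _ = (b , x∈p∩q⁺ (b∈ , side-g₁ b∼)) , (c , x∈p∩q⁺ (c∈ , side-g₂ c∼))
    meets 1ℙ 0ℙ b∼ c∼ _ = (c , x∈p∩q⁺ (c∈ , side-g₁ c∼)) , (b , x∈p∩q⁺ (b∈ , side-g₂ b∼))
    meets 0ℙ 0ℙ _  _  s≢t = ⊥-elim (s≢t refl)
    meets 1ℙ 1ℙ _  _  s≢t = ⊥-elim (s≢t refl)
    unique : ∀ {d d′} → (∀ {b} → B.Block b × set abc ⊆ b → set (d ∷ abc) ≡ b) → B⁺ (d′ ∷ abc) → d′ ≡ d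
    unique {d} {d′} uniq (block (fresh ∷ _) Blk) = set-∷-injective fresh
      (sym (uniq (Blk , set-⊆ {xs = abc} λ x∈ → ∈-set⁺ {xs = d′ ∷ abc} (there x∈))))
    unique _ (pairs _ τ) = ⊥-elim (a≢b (proj₁ (paired-split side τ a∼b b≁c)))
    complete : Mixed → Completion abc
    complete (meets₁ , meets₂) =
      let blk , (Blk , abc⊆) , uniq = B.covers (set abc) (∣set∣ u) meets₁ meets₂
          d , u′ , eq = extend-to u (B.blockSize Blk) abc⊆
      in d , block u′ (subst B.Block eq Blk) , unique λ b → trans (sym eq) (uniq b)

  complete-split : side a ≡ side b → side b ≢ side c → Completion (a ∷ b ∷ c ∷ [])
  complete-split {a} {b} a∼b b≁c with a Fin.≟ b
  ... | yes refl = complete-pair b≁c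
  ... | no  a≢b  = complete-distinct a≢b a∼b b≁c

  -- Among three sides two agree; a permutation brings these two points to the front.
  complete : ∀ a b c → ¬ (side a ≡ side c × side b ≡ side c) → Completion (a ∷ b ∷ c ∷ [])
  complete a b c mixed with side a ℙ.≟ side b | side a ℙ.≟ side c | side b ℙ.≟ side c
  ... | yes a∼b | _       | no b≁c = complete-split a∼b b≁c
  ... | yes a∼b | _       | yes b∼c = ⊥-elim (mixed (trans a∼b b∼c , b∼c))
  ... | no a≁b  | yes a∼c | _ = Completion-resp-↭ (prep a (swap c b ↭-refl))
    (complete-split a∼c (a≁b ∘ trans a∼c))
  ... | no a≁b  | no a≁c  | yes b∼c = Completion-resp-↭ (++-comm (b ∷ c ∷ []) (a ∷ []))
    (complete-split b∼c (a≁c ∘ sym))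
  ... | no a≁b  | no a≁c  | no b≁c = ⊥-elim (pigeonhole (side a) (side b) (side c) a≁b a≁c b≁c)
    where
    pigeonhole : ∀ s t u → s ≢ t → s ≢ u → ¬ t ≢ u
    pigeonhole 0ℙ 0ℙ u  s≢t _ _ = s≢t refl
    pigeonhole 1ℙ 1ℙ u  s≢t _ _ = s≢t refl
    pigeonhole 0ℙ 1ℙ 0ℙ _ s≢u _ = s≢u refl
    pigeonhole 0ℙ 1ℙ 1ℙ _ _ t≢u = t≢u refl
    pigeonhole 1ℙ 0ℙ 0ℙ _ _ t≢u = t≢u refl
    pigeonhole 1ℙ 0ℙ 1ℙ _ s≢u _ = s≢u refl

  -- Coloured points over the 3-BBD

  module _ {h} (cell : Residue h ↔ (Fin n × Parity × Parity))
           (par-side : ∀ g → par g ≡ side (proj₁ (Inverse.to cell g))) where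

    private
      G = Residue h

      base : G → Fin n
      base = proj₁ ∘ Inverse.to cell

      col₁ col₂ : G → Parity
      col₁ = proj₁ ∘ proj₂ ∘ Inverse.to cell
      col₂ = proj₂ ∘ proj₂ ∘ Inverse.to cell

      cell-ext : ∀ {g g′} → base g ≡ base g′ → col₁ g ≡ col₁ g′ → col₂ g ≡ col₂ g′ → g ≡ g′
      cell-ext b c₁ c₂ = Injection.injective (↔⇒↣ cell) (cong₂ _,_ b (cong₂ _,_ c₁ c₂))

    -- The four points over a base point are coloured by the Klein four-group, given by its two
    -- components; the colours of a quad sum to zero.
    record D (xs : List G) : Set where
      constructor mkD
      field
        over  : B⁺ (map base xs)
        zero₁ : Σℙ (map col₁ xs) ≡ 0ℙ
        zero₂ : Σℙ (map col₂ xs) ≡ 0ℙ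

    D-resp-↭ : ∀ {xs ys} → xs ↭ ys → D xs → D ys
    D-resp-↭ σ (mkD b z₁ z₂) = mkD (B⁺-resp-↭ (map⁺ base σ) b)
      (trans (sym (Σℙ-↭ (map⁺ col₁ σ))) z₁) (trans (sym (Σℙ-↭ (map⁺ col₂ σ))) z₂)

    private
      mixed-base : ∀ {a b c} → ¬ (par a ≡ par c × par b ≡ par c) →
        ¬ (side (base a) ≡ side (base c) × side (base b) ≡ side (base c))
      mixed-base {a} {b} {c} mixed (p , q) =
        mixed (trans (par-side a) (trans p (sym (par-side c)))
              , trans (par-side b) (trans q (sym (par-side c))))

    D-mixed : ∀ {w a b c} → D (w ∷ a ∷ b ∷ c ∷ []) → ¬ (par a ≡ par c × par b ≡ par c)
    D-mixed {w} {a} {b} {c} (mkD B⁺w _ _) (p , q) = B⁺-mixed B⁺w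
      ( trans (sym (par-side a)) (trans p (par-side c))
      , trans (sym (par-side b)) (trans q (par-side c)))

    -- The repeated point forces a `pairs` projection, so `b` and `c` have the same base point. The
    -- colours of the two copies of `a` cancel, so `b` and `c` also have the same colour.
    D-irreflexive : ∀ {a b c} → b ≢ c → ¬ D (a ∷ a ∷ b ∷ c ∷ [])
    D-irreflexive {a} {b} {c} b≢c (mkD (block ((a≢a ∷ _) ∷ _) _) _ _) = a≢a refl
    D-irreflexive {a} {b} {c} b≢c (mkD (pairs _ σ) z₁ z₂) =
      b≢c (cell-ext (paired σ) (cancel (col₁ a) (col₁ b) z₁) (cancel (col₂ a) (col₂ b) z₂))
      where
      cancel : ∀ s t {u} → s ⊕ (s ⊕ (t ⊕ (u ⊕ 0ℙ))) ≡ 0ℙ → t ≡ u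
      cancel 0ℙ 0ℙ {0ℙ} _ = refl
      cancel 0ℙ 1ℙ {1ℙ} _ = refl
      cancel 1ℙ 0ℙ {0ℙ} _ = refl
      cancel 1ℙ 1ℙ {1ℙ} _ = refl

    D-fresh : ∀ {w ts} → Unique ts → length ts ≡ 3 → D (w ∷ ts) → Fresh w ts
    D-fresh {w} {ts} u len d = All.tabulate λ { {x} x∈ refl → clash (∈-strip x∈) }
      where
      clash : ¬ (∃[ ys ] ts ↭ w ∷ ys)
      clash (ys , σ) = two ys (trans (sym (↭-length σ)) len) σ
        where
        two : ∀ ys → suc (length ys) ≡ 3 → ¬ (ts ↭ w ∷ ys)
        two (b ∷ c ∷ []) _ σ with _ ∷ (b≢c ∷ []) ∷ _ ← Unique-resp-↭ σ u =
          D-irreflexive b≢c (D-resp-↭ (prep w σ) d)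

    D-covers : ∀ {a b c} → Unique (a ∷ b ∷ c ∷ []) → ¬ (par a ≡ par c × par b ≡ par c) →
      ∃[ w ] Fresh w (a ∷ b ∷ c ∷ []) × D (w ∷ a ∷ b ∷ c ∷ []) ×
             (∀ {w′} → D (w′ ∷ a ∷ b ∷ c ∷ []) → w′ ≡ w)
    D-covers {a} {b} {c} u mixed with complete (base a) (base b) (base c) (mixed-base mixed)
    ... | e , B⁺e , uniq = z , D-fresh u refl Dz , Dz
        , λ { (mkD B⁺′ z₁ z₂) → cell-ext (trans (uniq B⁺′) (sym (cong proj₁ to-z)))
                (trans (opposite _ z₁) (sym (cong (proj₁ ∘ proj₂) to-z)))
                (trans (opposite _ z₂) (sym (cong (proj₂ ∘ proj₂) to-z))) }
      where
      abc = a ∷ b ∷ c ∷ []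
      target : Fin n × Parity × Parity
      -- Every colour is its own negative, so the missing colour is the sum of the other three.
      target = e , Σℙ (map col₁ abc) , Σℙ (map col₂ abc)
      z : G
      z = Inverse.from cell target
      to-z : Inverse.to cell z ≡ target
      to-z = Inverse.strictlyInverseˡ cell target
      Dz : D (z ∷ abc)
      Dz = mkD (subst (λ i → B⁺ (i ∷ map base abc)) (sym (cong proj₁ to-z)) B⁺e)
        (trans (cong (_⊕ Σℙ (map col₁ abc)) (cong (proj₁ ∘ proj₂) to-z)) (ℙ.p+p≡0ℙ (Σℙ (map col₁ abc))))
        (trans (cong (_⊕ Σℙ (map col₂ abc)) (cong (proj₂ ∘ proj₂) to-z)) (ℙ.p+p≡0ℙ (Σℙ (map col₂ abc))))
      opposite : ∀ s {t} → s ⊕ t ≡ 0ℙ → s ≡ t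
      opposite s {t} eq = ℙ.+-cancelʳ-≡ t s t (trans eq (sym (ℙ.p+p≡0ℙ t)))

-- Identification of the point sets

lookup-injective : ∀ {A : Set} {xs : List A} → Unique xs → Injective _≡_ _≡_ (lookup xs)
lookup-injective (_  ∷ u) {zero}  {zero}  _  = refl
lookup-injective (x∉ ∷ u) {zero}  {suc j} eq = ⊥-elim (All.lookup x∉ (∈-lookup j) eq)
lookup-injective (x∉ ∷ u) {suc i} {zero}  eq = ⊥-elim (All.lookup x∉ (∈-lookup i) (sym eq))
lookup-injective (_  ∷ u) {suc i} {suc j} eq = cong suc (lookup-injective u eq)

enumerate : ∀ {n k} (p : Subset n) → ∣ p ∣ ≡ k →
            Σ[ f ∈ (Fin k → Fin n) ] Injective _≡_ _≡_ f × (∀ i → f i ∈ p) ×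
            (∀ {x} → x ∈ p → ∃[ i ] f i ≡ x)
enumerate p ∣p∣≡k with elements-of-size p ∣p∣≡k
... | xs , u , refl , refl = lookup xs , lookup-injective u , (λ i → ∈-set⁺ {xs = xs} (∈-lookup i))
  , λ x∈ → index (∈-set⁻ xs x∈) , sym (lookup-index (∈-set⁻ xs x∈))

module _ {n} (B : 3-BBD n) where

  open 3-BBD B using (g₁; g₂)

  opaque
    halves : Σ[ k ∈ ℕ ] Σ[ σ ∈ (Parity × Fin k) ↔ Fin n ]
               (∀ i → Inverse.to σ (0ℙ , i) ∈ g₁) × (∀ i → Inverse.to σ (1ℙ , i) ∈ g₂)
    halves with enumerate g₁ refl | enumerate g₂ (sym (3-BBD.equalSize B))
    ... | e₁ , e₁-inj , e₁∈ , e₁-onto | e₂ , e₂-inj , e₂∈ , e₂-onto =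
      _ , ⤖⇒↔ (mk⤖ {to = e} (e-injective , λ x →
          e-onto x (x∈p∪q⁻ g₁ g₂ (subst (x ∈_) (sym (3-BBD.exhaust B)) ∈⊤))))
        , e₁∈ , e₂∈
      where
      e : Parity × Fin ∣ g₁ ∣ → Fin n
      e (0ℙ , i) = e₁ i
      e (1ℙ , i) = e₂ i
      apart : ∀ {x} → x ∈ g₁ → x ∈ g₂ → ∀ {A : Set} → A
      apart x∈₁ x∈₂ = ⊥-elim (∉⊥ (subst (_ ∈_) (3-BBD.disjoint B) (x∈p∩q⁺ (x∈₁ , x∈₂))))
      e-injective : Injective _≡_ _≡_ e
      e-injective {0ℙ , i} {0ℙ , j} eq = cong (0ℙ ,_) (e₁-inj eq)
      e-injective {1ℙ , i} {1ℙ , j} eq = cong (1ℙ ,_) (e₂-inj eq)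
      e-injective {0ℙ , i} {1ℙ , j} eq = apart (e₁∈ i) (subst (_∈ g₂) (sym eq) (e₂∈ j))
      e-injective {1ℙ , i} {0ℙ , j} eq = apart (e₁∈ j) (subst (_∈ g₂) eq (e₂∈ i))
      e-onto : ∀ x → x ∈ g₁ ⊎ x ∈ g₂ → ∃[ a ] (∀ {z} → z ≡ a → e z ≡ x)
      e-onto x (inj₁ x∈) = let i , eq = e₁-onto x∈ in (0ℙ , i) , λ { refl → eq }
      e-onto x (inj₂ x∈) = let i , eq = e₂-onto x∈ in (1ℙ , i) , λ { refl → eq }

Parity↔Fin2 : Parity ↔ Fin 2
Parity↔Fin2 = mk↔ₛ′ to from (λ { zero → refl ; (suc zero) → refl }) (λ { 0ℙ → refl ; 1ℙ → refl })
  where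
  to : Parity → Fin 2
  to 0ℙ = zero
  to 1ℙ = suc zero
  from : Fin 2 → Parity
  from zero    = 0ℙ
  from (suc _) = 1ℙ

Fin-cong : ∀ {m n} → m ≡ n → Fin m ↔ Fin n
Fin-cong refl = ↔-refl

Residue↔ : ∀ {h} → Residue h ↔ (Parity × Fin (2 * h))
Residue↔ = mk↔ₛ′ (λ g → par g , half g) (λ (t , x) → residue t x) (λ _ → refl) (λ _ → refl)

Point↔ : ∀ {h} → Point h ↔ ((Parity × Residue h) ⊎ Parity)
Point↔ {h} = mk↔ₛ′ to from
    (λ { (inj₁ (0ℙ , _)) → refl ; (inj₁ (1ℙ , _)) → refl ; (inj₂ _) → refl })
    (λ { (∞ _) → refl ; (left _) → refl ; (right _) → refl })
  where
  to : Point h → (Parity × Residue h) ⊎ Parity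
  to (∞ l)     = inj₂ l
  to (left g)  = inj₁ (0ℙ , g)
  to (right g) = inj₁ (1ℙ , g)
  from : (Parity × Residue h) ⊎ Parity → Point h
  from (inj₂ l)        = ∞ l
  from (inj₁ (0ℙ , g)) = left g
  from (inj₁ (1ℙ , g)) = right g

opaque
  points : ∀ h → Point h ↔ Fin (8 * h + 2)
  points h = ↔-trans Point↔ (↔-trans
      (↔-trans (Parity↔Fin2 ×-↔ residues) (↔-trans (↔-sym Fin.*↔×) (Fin-cong (count h))) ⊎-↔ Parity↔Fin2)
      (↔-sym Fin.+↔⊎))
    where
    residues : Residue h ↔ Fin (2 * (2 * h))
    residues = ↔-trans Residue↔ (↔-trans (Parity↔Fin2 ×-↔ ↔-refl) (↔-sym Fin.*↔×))
    count : ∀ h → 2 * (2 * (2 * h)) ≡ 8 * h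
    count = solve-∀

module _ {h : ℕ} where

  pt : Side → Residue h → Point h
  pt s g = Inverse.from Point↔ (inj₁ (s , g))

  flatPoint : Side × Parity → Fin (2 * h) ⊎ Parity → Point h
  flatPoint (s , t) (inj₁ x) = pt s (residue t x)
  flatPoint _       (inj₂ l) = ∞ l

  flatPoint-injective : ∀ i → Injective _≡_ _≡_ (flatPoint i)
  flatPoint-injective (0ℙ , _) {inj₁ _} {inj₁ _} refl = refl
  flatPoint-injective (1ℙ , _) {inj₁ _} {inj₁ _} refl = refl
  flatPoint-injective (0ℙ , _) {inj₁ _} {inj₂ _} ()
  flatPoint-injective (1ℙ , _) {inj₁ _} {inj₂ _} ()
  flatPoint-injective (0ℙ , _) {inj₂ _} {inj₁ _} ()
  flatPoint-injective (1ℙ , _) {inj₂ _} {inj₁ _} ()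
  flatPoint-injective _        {inj₂ _} {inj₂ _} refl = refl

  flatPoint-flat : ∀ i a → Flat i (flatPoint i a)
  flatPoint-flat (0ℙ , _) (inj₁ _) = refl , refl
  flatPoint-flat (1ℙ , _) (inj₁ _) = refl , refl
  flatPoint-flat _        (inj₂ _) = tt

  flatPoint-onto : ∀ i {x} → Flat i x → ∃[ a ] flatPoint i a ≡ x
  flatPoint-onto _ {∞ l}     _             = inj₂ l , refl
  flatPoint-onto _ {left g}  (refl , refl) = inj₁ (half g) , refl
  flatPoint-onto _ {right g} (refl , refl) = inj₁ (half g) , refl

  opaque
    flat↔ : Fin (2 * h + 2) ↔ (Fin (2 * h) ⊎ Parity)
    flat↔ = ↔-trans Fin.+↔⊎ (↔-refl ⊎-↔ ↔-sym Parity↔Fin2)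

  φ : Side × Parity → Fin (2 * h + 2) → Point h
  φ i = flatPoint i ∘ Inverse.to flat↔

  φ-injective : ∀ i → Injective _≡_ _≡_ (φ i)
  φ-injective i = Injection.injective (↔⇒↣ flat↔) ∘ flatPoint-injective i

  φ-flat : ∀ i a → Flat i (φ i a)
  φ-flat i a = flatPoint-flat i (Inverse.to flat↔ a)

  φ-onto : ∀ i {x} → Flat i x → ∃[ a ] φ i a ≡ x
  φ-onto i fx = let a , eq = flatPoint-onto i fx in
    Inverse.from flat↔ a , trans (cong (flatPoint i) (Inverse.strictlyInverseˡ flat↔ a)) eq

∞-flats-meet : ∀ {h} {i j : Side × Parity} {x : Point h} →
               Flat i x → Flat j x → (∃[ l ] x ≡ ∞ l) ⊎ i ≡ j
∞-flats-meet {x = ∞ l}     _             _             = inj₁ (l , refl)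
∞-flats-meet {x = left _}  (refl , refl) (refl , refl) = inj₂ refl
∞-flats-meet {x = right _} (refl , refl) (refl , refl) = inj₂ refl

-- A common point other than the two points ∞ determines the flat, and three distinct points cannot
-- all be among those two.
flats-meet : ∀ {h} {i j} {ts : List (Point h)} → Unique ts → length ts ≡ 3 →
             All (Flat i) ts → All (Flat j) ts → i ≡ j
flats-meet {ts = x ∷ y ∷ z ∷ []} u _ (fx ∷ fy ∷ fz ∷ []) (fx′ ∷ fy′ ∷ fz′ ∷ [])
  with ∞-flats-meet fx fx′ | ∞-flats-meet fy fy′ | ∞-flats-meet fz fz′
... | inj₂ i≡j        | _               | _               = i≡j
... | inj₁ _          | inj₂ i≡j        | _               = i≡j
... | inj₁ _          | inj₁ _          | inj₂ i≡j        = i≡j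
... | inj₁ (0ℙ , refl) | inj₁ (0ℙ , refl) | inj₁ _          with (x≢y ∷ _) ∷ _ ← u = ⊥-elim (x≢y refl)
... | inj₁ (1ℙ , refl) | inj₁ (1ℙ , refl) | inj₁ _          with (x≢y ∷ _) ∷ _ ← u = ⊥-elim (x≢y refl)
... | inj₁ (0ℙ , refl) | inj₁ (1ℙ , refl) | inj₁ (0ℙ , refl) with (_ ∷ x≢z ∷ _) ∷ _ ← u = ⊥-elim (x≢z refl)
... | inj₁ (0ℙ , refl) | inj₁ (1ℙ , refl) | inj₁ (1ℙ , refl) with _ ∷ (y≢z ∷ _) ∷ _ ← u = ⊥-elim (y≢z refl)
... | inj₁ (1ℙ , refl) | inj₁ (0ℙ , refl) | inj₁ (1ℙ , refl) with (_ ∷ x≢z ∷ _) ∷ _ ← u = ⊥-elim (x≢z refl)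
... | inj₁ (1ℙ , refl) | inj₁ (0ℙ , refl) | inj₁ (0ℙ , refl) with _ ∷ (y≢z ∷ _) ∷ _ ← u = ⊥-elim (y≢z refl)

-- The extended system and the copies it contains

module Construction (n : ℕ) .{{_ : NonZero n}} {K : Pred ℕ 0ℓ} (K4 : K 4)
  (S : SteinerSystem₃ K (2 * n + 2)) (B : 3-BBD n) where

  private
    k = proj₁ (halves B)
    σ : (Parity × Fin k) ↔ Fin n
    σ = proj₁ (proj₂ (halves B))

  side : Fin n → Parity
  side = proj₁ ∘ Inverse.from σ

  side-g : ∀ t (g : Subset n) → (∀ i → Inverse.to σ (t , i) ∈ g) → ∀ {x} → side x ≡ t → x ∈ g
  side-g t g σ∈ {x} refl = subst (_∈ g) (Inverse.strictlyInverseˡ σ x) (σ∈ (proj₂ (Inverse.from σ x)))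

  n≡2k : n ≡ 2 * k
  n≡2k = ↔⇒≡ (↔-trans (↔-sym σ) (↔-trans (Parity↔Fin2 ×-↔ ↔-refl) (↔-sym Fin.*↔×)))

  opaque
    -- Each parity class has `2 * n = k * (2 * 2)` residues, four for each of the `k` points of a
    -- group. The bijection matches parity with side and is otherwise arbitrary, as addition of
    -- residues enters only the cross blocks.
    cell : Residue n ↔ (Fin n × Parity × Parity)
    cell = ↔-trans Residue↔ (↔-trans (↔-refl ×-↔ half↔)
        (↔-trans (↔-sym (×-assoc 0ℓ _ _ _)) (σ ×-↔ ↔-refl)))
      where
      count : ∀ k → 2 * (2 * k) ≡ k * (2 * 2)
      count = solve-∀
      half↔ : Fin (2 * n) ↔ (Fin k × Parity × Parity)
      half↔ = ↔-trans (Fin-cong (trans (cong (2 *_) n≡2k) (count k)))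
        (↔-trans Fin.*↔× (↔-refl ×-↔ ↔-trans (Fin.*↔× {2} {2}) (↔-sym Parity↔Fin2 ×-↔ ↔-sym Parity↔Fin2)))

    par-side : ∀ g → par g ≡ side (proj₁ (Inverse.to cell g))
    par-side g = sym (cong proj₁ (Inverse.strictlyInverseʳ σ _))

  open Inflation B side
    (side-g 0ℙ _ (proj₁ (proj₂ (proj₂ (halves B)))))
    (side-g 1ℙ _ (proj₂ (proj₂ (proj₂ (halves B)))))
  open Quads n (D cell par-side) (D-resp-↭ cell par-side) (D-mixed cell par-side) (D-covers cell par-side)
  open Assembly Flat R
  open System R-resp-↭ K4 S (points n) φ φ-injective φ-flat φ-onto flats-meet cover public

  -- The copy of `B` is placed on the left points of colour zero, where the colour condition on
  -- quads holds automatically.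
  atOrigin : Fin n → Residue n
  atOrigin i = Inverse.from cell (i , 0ℙ , 0ℙ)

  cell-atOrigin : ∀ i → Inverse.to cell (atOrigin i) ≡ (i , 0ℙ , 0ℙ)
  cell-atOrigin i = Inverse.strictlyInverseˡ cell (i , 0ℙ , 0ℙ)

  atOrigin-injective : Injective _≡_ _≡_ atOrigin
  atOrigin-injective eq = cong proj₁
    (Injection.injective (↔⇒↣ (↔-sym cell)) {_ , 0ℙ , 0ℙ} {_ , 0ℙ , 0ℙ} eq)

  D-block : ∀ {xs} → Unique xs → 3-BBD.Block B (set xs) → D cell par-side (map atOrigin xs)
  D-block {xs} u Bb = mkD
      (subst B⁺ (sym (trans (sym (map-∘ xs)) (trans (map-cong (cong proj₁ ∘ cell-atOrigin) xs) (map-id xs))))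
        (block u Bb))
      (zero-colour (cong (proj₁ ∘ proj₂) ∘ cell-atOrigin) xs)
      (zero-colour (cong (proj₂ ∘ proj₂) ∘ cell-atOrigin) xs)
    where
    zero-colour : ∀ {c : Residue n → Parity} → (∀ i → c (atOrigin i) ≡ 0ℙ) →
                  ∀ xs → Σℙ (map c (map atOrigin xs)) ≡ 0ℙ
    zero-colour c≡0 []       = refl
    zero-colour c≡0 (x ∷ xs) rewrite c≡0 x = zero-colour c≡0 xs

  placeB : Fin n → Fin (8 * n + 2)
  placeB = enc ∘ left ∘ atOrigin

  left-injective : Injective _≡_ _≡_ (left {n})
  left-injective refl = refl

  leftOrigin-injective : Injective _≡_ _≡_ (left ∘ atOrigin)
  leftOrigin-injective = atOrigin-injective ∘ left-injective

  R-left : ∀ {a b c d} → D cell par-side (a ∷ b ∷ c ∷ d ∷ []) → R (left a ∷ left b ∷ left c ∷ left d ∷ [])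
  R-left = onLeft

  placeB-set : ∀ {xs} → Unique xs → length xs ≡ 4 → 3-BBD.Block B (set xs) → Block (set (map placeB xs))
  placeB-set {xs} u len Bb = subst (λ ys → Block (set ys)) (sym (map-∘ xs))
      (quad {xs = map (left ∘ atOrigin) xs}
        (Unique.map⁺ leftOrigin-injective u) (trans (length-map _ xs) len)
        (R-xs xs len (D-block u Bb)))
    where
    R-xs : ∀ xs → length xs ≡ 4 → D cell par-side (map atOrigin xs) → R (map (left ∘ atOrigin) xs)
    R-xs (_ ∷ _ ∷ _ ∷ _ ∷ []) _ = R-left

  placeB-block : ∀ {b} → 3-BBD.Block B b → Block (image placeB b)
  placeB-block {b} Bb =
    let xs , u , b≡ , len = elements-of-size b (3-BBD.blockSize B Bb) in
    subst Block (sym (trans (cong (image placeB) b≡) (image-set placeB xs)))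
      (placeB-set u len (subst (3-BBD.Block B) b≡ Bb))

  extension : Σ[ S′ ∈ SteinerSystem₃ K (8 * n + 2) ]
    (SteinerSystem₃.Block S′ ContainsCopyOf SteinerSystem₃.Block S) ×
    (SteinerSystem₃.Block S′ ContainsCopyOf 3-BBD.Block B)
  extension = system
    , (place (0ℙ , 0ℙ) , place-injective (0ℙ , 0ℙ) , flat (0ℙ , 0ℙ))
    , (placeB , leftOrigin-injective ∘ enc-injective , placeB-block)

theorem2 : ∀ (n : ℕ) → 75 < n → 2 ∣ n →
    ((S : SteinerQuadrupleSystem (2 * n + 2)) (B : 3-BBD n) →
    Σ[ S′ ∈ SteinerQuadrupleSystem (8 * n + 2) ]
    (SteinerSystem₃.Block S′ ContainsCopyOf SteinerSystem₃.Block S) ×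
    (SteinerSystem₃.Block S′ ContainsCopyOf 3-BBD.Block B))
    ×
    ((S : S₃⟨4,6⟩ (2 * n + 2)) (B : 3-BBD n) →
    Σ[ S′ ∈ S₃⟨4,6⟩ (8 * n + 2) ]
    (SteinerSystem₃.Block S′ ContainsCopyOf SteinerSystem₃.Block S) ×
    (SteinerSystem₃.Block S′ ContainsCopyOf 3-BBD.Block B))
-- Quads have size four, which both kinds of system admit; every other block has the size of a block
-- of `S`.
theorem2 n 75<n _ = Construction.extension n refl , Construction.extension n (inj₁ refl)
  where
  instance
    n≢0 : NonZero n
    n≢0 = >-nonZero (ℕ.≤-<-trans z≤n 75<n)
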